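{- Let $n\ge 1$ and $x=(x_1,\dots,x_n)\in\mathbb{N}^n$. Let $P_n(x)$ denote the number of $x$-parking functions and $\mathrm{park}(n)$ the set of parking functions of length $n$. Then $$P_n(x)=\sum_{(a_1,\dots,a_n)\in\mathrm{park}(n)}x_{a_1}\cdots x_{a_n}=n!\,V_n(x).$$
   Context: $\mathbb N=\{0,1,2,\dots\}$. A parking function of length $n$ is a sequence $(a_1,\dots,a_n)$ of positive integers whose increasing rearrangement $b_1\le\cdots\le b_n$ satisfies $b_i\le i$ for all $i$. An $x$-parking function is a sequence $(a_1,\dots,a_n)$ of positive integers whose increasing rearrangement $b_1\le\cdots\le b_n$ satisfies $b_i\le x_1+\cdots+x_i$ for all $i$. $V_n$ is the volume polynomial: for $x_i>0$, $V_n(x)$ is the $n$-dimensional volume of $\Pi_n(x)=\{y\in\mathbb{R}^n: y_i\ge 0,\ y_1+\cdots+y_i\le x_1+\cdots+x_i \text{ for all } 1\le i\le n\}$; this is a homogeneous polynomial of degree $n$ in $x_1,\dots,x_n$, evaluated as a polynomial for nonnegative $x$ (where it still equals the volume).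
   Formalization: The volume of Π_n(x) is taken as Jordan content using rational points y and boxes with rational corners, and V_n is characterized as the polynomial giving this volume at nonnegative rational (rather than real) x. -}

module Defs where

open import Data.List.Base as List using (List; length; filter; upTo)
open import Data.List.Extrema.Nat using (max; xs≤max)
open import Data.List.Membership.Propositional using (_∈_)
open import Data.List.Membership.Propositional.Properties
  using (∈-cartesianProductWith⁺; ∈-filter⁺; ∈-filter⁻; ∈-map⁺; ∈-upTo⁺)
open import Data.List.Relation.Binary.Permutation.Propositional.Properties using (All-resp-↭)
open import Data.List.Relation.Binary.Pointwise as ListPointwise using ([]; _∷_)
open import Data.List.Relation.Unary.All as ListAll using ([]; _∷_)
open import Data.List.Relation.Unary.AllPairs using (AllPairs; []; _∷_)
open import Data.List.Relation.Unary.Any as ListAny using (here)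
open import Data.List.Relation.Unary.Unique.Propositional using (Unique)
open import Data.List.Relation.Unary.Unique.Propositional.Properties
  using (cartesianProductWith⁺; filter⁺; map⁺; upTo⁺)
open import Data.Fin.Base using (Fin; toℕ)
open import Data.Integer.Base using (+_)
open import Data.Nat.Base as ℕ using (ℕ; zero; suc; s≤s; z≤n)
import Data.Nat.Properties as ℕ
open import Data.Product.Base using (Σ; ∃; _×_; _,_; proj₂)
open import Data.Rational.Base as ℚ using (ℚ; 0ℚ; 1ℚ)
open import Data.Sum.Base using (_⊎_)
open import Data.Vec.Base as Vec using (Vec; []; _∷_; toList; lookup)
open import Data.Vec.Properties using (∷-injective)
open import Data.Vec.Relation.Binary.Pointwise.Inductive as VecPointwise using ()
open import Data.Vec.Relation.Unary.All as VecAll using ([]; _∷_)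
open import Data.Vec.Relation.Unary.All.Properties using (toList⁻)
open import Function.Bundles using (_⇔_; mk⇔)
open import Level using (0ℓ)
open import Relation.Binary.Core using (Rel)
open import Relation.Binary.PropositionalEquality.Core using (refl)
open import Relation.Nullary.Decidable using (_×-dec_)
open import Relation.Unary using (Pred; Decidable)
open import Algebra.Definitions.RawSemiring ℚ.+-*-rawSemiring using (_^_)
open import Data.List.Sort ℕ.≤-decTotalOrder using (sort; sort-↭)

private
  variable
    A : Set
    n : ℕ

prefixSums : (A → A → A) → Vec A n → Vec A n
prefixSums _∙_ []       = []
prefixSums _∙_ (x ∷ xs) = x ∷ Vec.map (x ∙_) (prefixSums _∙_ xs)

-- Sequences of positive integers whose increasing rearrangement
-- b₁ ≤ ⋯ ≤ bₙ satisfies bᵢ ≤ uᵢ for all i.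

RearrangesBelow : Vec ℕ n → Pred (Vec ℕ n) 0ℓ
RearrangesBelow u a =
  VecAll.All (1 ℕ.≤_) a × ListPointwise.Pointwise ℕ._≤_ (sort (toList a)) (toList u)

IsParkingFunction : Pred (Vec ℕ n) 0ℓ
IsParkingFunction = RearrangesBelow (Vec.tabulate λ i → suc (toℕ i))

IsXParkingFunction : Vec ℕ n → Pred (Vec ℕ n) 0ℓ
IsXParkingFunction x = RearrangesBelow (prefixSums ℕ._+_ x)

rearrangesBelow? : (u : Vec ℕ n) → Decidable (RearrangesBelow u)
rearrangesBelow? u a =
  VecAll.all? (1 ℕ.≤?_) a ×-dec
  ListPointwise.decidable ℕ._≤?_ (sort (toList a)) (toList u)

words : List A → ∀ n → List (Vec A n)
words xs zero    = List.[ [] ]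
words xs (suc n) = List.cartesianProductWith _∷_ xs (words xs n)

-- The entries of a sequence that rearranges below u are at most max u, so
-- only finitely many candidates need to be filtered; ∈-allBelow and
-- allBelow-unique confirm that each such sequence is listed exactly once.

allBelow : Vec ℕ n → List (Vec ℕ n)
allBelow {n} u =
  filter (rearrangesBelow? u) (words (List.map suc (upTo (max 0 (toList u)))) n)

park : ∀ n → List (Vec ℕ n)
park n = allBelow (Vec.tabulate λ i → suc (toℕ i))

P : Vec ℕ n → ℕ
P x = length (allBelow (prefixSums ℕ._+_ x))

words-unique : {xs : List A} → Unique xs → ∀ n → Unique (words xs n)
words-unique xs! zero    = [] ∷ []
words-unique xs! (suc n) = cartesianProductWith⁺ _∷_ ∷-injective xs! (words-unique xs! n)

∈-words : {xs : List A} {a : Vec A n} → VecAll.All (_∈ xs) a → a ∈ words xs n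
∈-words []         = here refl
∈-words (px ∷ pxs) = ∈-cartesianProductWith⁺ _∷_ px (∈-words pxs)

allBelow-unique : (u : Vec ℕ n) → Unique (allBelow u)
allBelow-unique {n} u =
  filter⁺ (rearrangesBelow? u) (words-unique (map⁺ ℕ.suc-injective (upTo⁺ _)) n)

∈-allBelow : (u a : Vec ℕ n) → a ∈ allBelow u ⇔ RearrangesBelow u a
∈-allBelow {n} u a = mk⇔
  (λ a∈ → proj₂ (∈-filter⁻ (rearrangesBelow? u) {xs = words letters n} a∈))
  (λ r@(pos , below) → ∈-filter⁺ (rearrangesBelow? u) (∈-words (inRange pos (bounded below))) r)
  where
  m = max 0 (toList u)
  letters = List.map suc (upTo m)

  pointwise⇒≤ : ∀ {bs us} → ListPointwise.Pointwise ℕ._≤_ bs us →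
                ListAll.All (ℕ._≤ m) us → ListAll.All (ℕ._≤ m) bs
  pointwise⇒≤ []       []       = []
  pointwise⇒≤ (p ∷ ps) (q ∷ qs) = ℕ.≤-trans p q ∷ pointwise⇒≤ ps qs

  bounded : ListPointwise.Pointwise ℕ._≤_ (sort (toList a)) (toList u) → VecAll.All (ℕ._≤ m) a
  bounded ps = toList⁻ (All-resp-↭ (sort-↭ (toList a)) (pointwise⇒≤ ps (xs≤max 0 (toList u))))

  inRange : ∀ {k} {b : Vec ℕ k} → VecAll.All (1 ℕ.≤_) b → VecAll.All (ℕ._≤ m) b →
            VecAll.All (_∈ letters) b
  inRange []             []       = []
  inRange (s≤s z≤n ∷ ps) (q ∷ qs) = ∈-map⁺ suc (∈-upTo⁺ q) ∷ inRange ps qs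

-- Indexing starts at 1. Indices outside 1, …, n give 0, but the entries of a
-- parking function of length n never leave that range.

infixl 9 _‼_
_‼_ : Vec ℕ n → ℕ → ℕ
[]       ‼ _           = 0
(x ∷ xs) ‼ 0           = 0
(x ∷ xs) ‼ 1           = x
(x ∷ xs) ‼ suc (suc k) = xs ‼ suc k

-- x_{a₁} ⋯ x_{aₙ}

parkingMonomial : Vec ℕ n → Vec ℕ n → ℕ
parkingMonomial x a = Vec.foldr′ ℕ._*_ 1 (Vec.map (x ‼_) a)

-- Volume is Jordan content: inner approximation by finitely many boxes with
-- disjoint interiors, outer approximation by finite covers with boxes. Points
-- and corners are rational. For a closed set of ℝⁿ in which the rational
-- points are dense, a closed box with rational corners lies in the set iff its
-- rational points do, and finitely many closed boxes cover the set iff they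
-- cover its rational points, so the content is that of the real set.

record Box (n : ℕ) : Set where
  field
    lower upper : Vec ℚ n
    lower≤upper : VecPointwise.Pointwise ℚ._≤_ lower upper

open Box public

infix 4 _∈ᵇ_
_∈ᵇ_ : Vec ℚ n → Box n → Set
y ∈ᵇ B = VecPointwise.Pointwise ℚ._≤_ (lower B) y × VecPointwise.Pointwise ℚ._≤_ y (upper B)

boxVolume : Box n → ℚ
boxVolume B = Vec.foldr′ ℚ._*_ 1ℚ (Vec.zipWith ℚ._-_ (upper B) (lower B))

totalVolume : List (Box n) → ℚ
totalVolume Bs = List.foldr ℚ._+_ 0ℚ (List.map boxVolume Bs)

NonOverlapping : Rel (Box n) 0ℓ
NonOverlapping {n} B C = Σ (Fin n) λ i →
  lookup (upper B) i ℚ.≤ lookup (lower C) i ⊎ lookup (upper C) i ℚ.≤ lookup (lower B) i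

record HasVolume (S : Pred (Vec ℚ n) 0ℓ) (v : ℚ) : Set where
  field
    inner : ∀ ε → 0ℚ ℚ.< ε → ∃ λ (Bs : List (Box n)) →
      AllPairs NonOverlapping Bs ×
      ListAll.All (λ B → ∀ y → y ∈ᵇ B → S y) Bs ×
      v ℚ.- ε ℚ.≤ totalVolume Bs
    outer : ∀ ε → 0ℚ ℚ.< ε → ∃ λ (Bs : List (Box n)) →
      (∀ y → S y → ListAny.Any (y ∈ᵇ_) Bs) ×
      totalVolume Bs ℚ.≤ v ℚ.+ ε

Π : Vec ℚ n → Pred (Vec ℚ n) 0ℓ
Π x y =
  VecAll.All (0ℚ ℚ.≤_) y ×
  VecPointwise.Pointwise ℚ._≤_ (prefixSums ℚ._+_ y) (prefixSums ℚ._+_ x)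

-- A polynomial is a list of coefficients with exponent vectors.

Polynomial : ℕ → Set
Polynomial n = List (ℚ × Vec ℕ n)

eval : Polynomial n → Vec ℚ n → ℚ
eval V x = List.foldr ℚ._+_ 0ℚ (List.map term V)
  where
  term : ℚ × Vec ℕ _ → ℚ
  term (c , e) = c ℚ.* Vec.foldr′ ℚ._*_ 1ℚ (Vec.zipWith _^_ x e)

-- A polynomial function on ℝⁿ is determined by its values at positive rational
-- points. Zero coordinates are included because the volume formula holds there too.

IsVolumePolynomial : Polynomial n → Set
IsVolumePolynomial {n} V =
  ∀ (x : Vec ℚ n) → VecAll.All (0ℚ ℚ.≤_) x → HasVolume (Π x) (eval V x)

fromℕ : ℕ → ℚ
fromℕ k = + k ℚ./ 1

{-# OPTIONS --safe #-}

-- Both equalities are read off from weighted sums over words.  A sequence a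
-- is an x-parking function iff the word of indices of the intervals
-- (x₁+⋯+xᵢ₋₁, x₁+⋯+xᵢ] containing its entries is a parking function, and the
-- i-th interval has xᵢ elements; this gives P(x) = Σ x_{a₁}⋯x_{aₙ}.
-- For the volume, put V(x) = (1/n!) Σ x_{a₁}⋯x_{aₙ}.  As a function of x₁ its
-- increments are squeezed by those of ∫ V(s + x₂, x₃, …, xₙ) ds, because
-- deleting a letter 1 from a parking function and identifying the letters 1
-- and 2 leaves a parking function of length n - 1.  Slicing Π(x) at y₁ = x₁ - s
-- gives Π(s + x₂, x₃, …, xₙ), so by induction on n the volume of Π(x) lies
-- between Riemann sums of slice volumes whose difference telescopes.

module Submission where

open import Defs
open import Data.Nat.Base using (ℕ; _≤_; _!)
open import Data.List.Base as List using ()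
open import Data.Nat.ListAction using (sum)
open import Data.Vec.Base as Vec using (Vec)
open import Data.Rational.Base using (_*_)
open import Data.Product.Base using (∃; _×_)
open import Relation.Binary.PropositionalEquality.Core using (_≡_)

open import Algebra.Bundles using (CommutativeRing)
open import Data.Bool.Base using (if_then_else_; true; false)
open import Data.Fin.Base using (zero; suc; toℕ)
open import Data.Fin.Properties using (toℕ<n)
import Data.Integer.Base as ℤ
import Data.Integer.Properties as ℤ
open import Data.List.Base using (List; []; _∷_; upTo)
open import Data.List.Extrema.Nat using (max; max≤v⁺; v≤max⁺)
open import Data.List.Properties using (map-cong)
open import Data.List.Relation.Binary.Permutation.Propositional
  using (_↭_; ↭-refl; ↭-sym; ↭-trans; ↭-prep; ↭-swap; ↭⇒↭ₛ)
import Data.List.Relation.Binary.Permutation.Propositional.Properties as Perm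
open import Data.List.Relation.Binary.Pointwise as ListPointwise using ([]; _∷_; Pointwise-≡⇒≡)
open import Data.List.Relation.Unary.All as ListAll using (All; []; _∷_)
import Data.List.Relation.Unary.All.Properties as ListAll
open import Data.List.Relation.Unary.AllPairs as AllPairs using (AllPairs; []; _∷_)
import Data.List.Relation.Unary.AllPairs.Properties as AllPairs
open import Data.List.Relation.Unary.Any as ListAny using (here; there)
import Data.List.Relation.Unary.Any.Properties as ListAny
open import Data.List.Relation.Unary.Sorted.TotalOrder.Properties as Sorted using (↗↭↗⇒≋)
open import Data.Nat.Base as ℕ using (zero; suc; s≤s; z≤n)
import Data.Nat.Properties as ℕ
open import Data.List.Relation.Unary.Sorted.TotalOrder ℕ.≤-totalOrder using (Sorted)
open import Data.List.Sort ℕ.≤-decTotalOrder using (sort; sort-↭; sort-↗)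
open import Data.Product.Base using (_,_; proj₁; proj₂)
open import Data.Rational.Base as ℚ using (ℚ; 0ℚ; 1ℚ; _+_; _-_)
import Data.Rational.Properties as ℚ
open import Data.Rational.Solver using (module +-*-Solver)
open import Data.Rational.Unnormalised.Base as ℚᵘ using (mkℚᵘ; *≡*; *≤*)
import Data.Rational.Unnormalised.Properties as ℚᵘ
open import Data.Sum.Base as Sum using (_⊎_; inj₁; inj₂)
open import Data.Vec.Base using ([]; _∷_; toList; lookup)
open import Data.Vec.Properties using (toList-map; tabulate-∘)
open import Data.Vec.Relation.Binary.Pointwise.Inductive as VecPointwise using (Pointwise; []; _∷_)
open import Data.Vec.Relation.Unary.All as VecAll using ([]; _∷_)
import Data.Vec.Relation.Unary.All.Properties as VecAll
open import Data.Vec.Relation.Unary.Any as VecAny using (here; there)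
import Data.Vec.Relation.Unary.Any.Properties as VecAny
open import Function.Base using (_∘_; id)
open import Function.Bundles using (_⇔_; mk⇔; Equivalence)
open import Relation.Binary.Core using (_Preserves_⟶_)
open import Relation.Binary.PropositionalEquality
  using (refl; sym; trans; cong; cong₂; subst; module ≡-Reasoning)
open import Relation.Nullary using (contradiction)
open import Relation.Nullary.Decidable using (Dec; does; yes; no; dec-true; does-⇔)
open import Relation.Unary using (Decidable)
import Algebra.Properties.Semiring.Exp (CommutativeRing.semiring ℚ.+-*-commutativeRing) as Exp
open import Algebra.Definitions.RawSemiring ℚ.+-*-rawSemiring using (_^_)
open import Algebra.Properties.Semiring.Sum (CommutativeRing.semiring ℚ.+-*-commutativeRing)
  using (sum-cong-≗; ∑-distrib-+; *-distribˡ-sum; sum-replicate-zero) renaming (sum to sumᶠ)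

open Equivalence using (to; from)
open +-*-Solver using (solve; _:+_; _:*_; _:-_; _:=_; con)

-- Two maps of letters carry the combinatorics: `block`, which sends an entry to its interval, and
-- `collapse`. Both are monotone and have an upper adjoint at the bounds that matter. Monotone maps
-- commute with sorting and adjunction moves the bounds, so one lemma transports the parking
-- condition along either map. On the side of sums both act by pushing forward a weight on letters,
-- and a sum over words with product weights follows letter by letter. The volume side has only
-- finite families of rational boxes to work with, so the differential equation ∂V/∂x₁ = V(x₁ + x₂,
-- x₃, ...) appears as two inequalities between finite increments. Its source is that raising the
-- weight of the letter 1 changes a sum over words of length n + 1 in n + 1 positions; by symmetry
-- all of them contribute alike, and the factor n + 1 turns 1/(n+1)! into 1/n!. The initial value at
-- x₁ = 0 is 0 because every parking function contains the letter 1.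

private
  variable
    A : Set
    m n : ℕ

-- Sorting and parking functions

-- A sorted rearrangement is unique. All facts about `sort` below come from this characterization
-- and not from the algorithm, even the value at the empty list.
sort-unique : ∀ {xs ys} → xs ↭ ys → Sorted ys → sort xs ≡ ys
sort-unique {xs} xs↭ys ys↗ =
  Pointwise-≡⇒≡ (↗↭↗⇒≋ ℕ.≤-totalOrder (sort-↗ xs) ys↗ (↭⇒↭ₛ (↭-trans (sort-↭ xs) xs↭ys)))

sort-cong : ∀ {xs ys} → xs ↭ ys → sort xs ≡ sort ys
sort-cong {_} {ys} xs↭ys = sort-unique (↭-trans xs↭ys (↭-sym (sort-↭ ys))) (sort-↗ ys)

sort-map : ∀ {g} → g Preserves _≤_ ⟶ _≤_ → ∀ xs → sort (List.map g xs) ≡ List.map g (sort xs)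
sort-map {g} g-mono xs =
  sort-unique (Perm.map⁺ g (↭-sym (sort-↭ xs)))
    (Sorted.map⁺ ℕ.≤-totalOrder ℕ.≤-totalOrder g-mono (sort-↗ xs))

sort-∷ : ∀ {x xs} → ListAll.All (x ≤_) xs → sort (x ∷ xs) ≡ x ∷ sort xs
sort-∷ {x} {xs} x≤xs =
  sort-unique (↭-prep x (↭-sym (sort-↭ xs)))
    (Sorted.AllPairs⇒Sorted ℕ.≤-totalOrder
      (Perm.All-resp-↭ (↭-sym (sort-↭ xs)) x≤xs ∷ Sorted.Sorted⇒AllPairs ℕ.≤-totalOrder (sort-↗ xs)))

rearrangesBelow-resp-↭ : (u : Vec ℕ n) {a b : Vec ℕ n} → toList a ↭ toList b →
                         RearrangesBelow u a → RearrangesBelow u b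
rearrangesBelow-resp-↭ u a↭b (pos , below) =
  VecAll.toList⁻ (Perm.All-resp-↭ a↭b (VecAll.toList⁺ pos)) ,
  subst (λ xs → ListPointwise.Pointwise _≤_ xs (toList u)) (sort-cong a↭b) below

-- A Galois connection at a single point: q is the value at p of the upper adjoint of `g`. It is
-- asked for only at 0 and at the bounds of the sorted entries.
GaloisAt : (ℕ → ℕ) → ℕ → ℕ → Set
GaloisAt g p q = ∀ l → g l ≤ p ⇔ l ≤ q

-- Since `g` commutes with sorting, the i-th smallest entries correspond, and the adjunction
-- translates each bound. The adjunction at 0 translates positivity.
rearrangesBelow-map : ∀ {g} → g Preserves _≤_ ⟶ _≤_ → GaloisAt g 0 0 →
  {v u : Vec ℕ n} → VecPointwise.Pointwise (GaloisAt g) v u →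
  (a : Vec ℕ n) → RearrangesBelow u a ⇔ RearrangesBelow v (Vec.map g a)
rearrangesBelow-map {g = g} g-mono g₀ {v} {u} adj a = mk⇔
  (λ (pos , below) → pos⇒ pos ,
    subst (λ xs → ListPointwise.Pointwise _≤_ xs (toList v)) sorted (below⇒ adj below))
  (λ (pos , below) → pos⇐ a pos ,
    below⇐ adj (subst (λ xs → ListPointwise.Pointwise _≤_ xs (toList v)) (sym sorted) below))
  where
  sorted : List.map g (sort (toList a)) ≡ sort (toList (Vec.map g a))
  sorted = trans (sym (sort-map g-mono (toList a))) (cong sort (sym (toList-map g a)))

  pos⇒ : ∀ {k} {a : Vec ℕ k} → VecAll.All (1 ≤_) a → VecAll.All (1 ≤_) (Vec.map g a)
  pos⇒ []       = []
  pos⇒ (p ∷ ps) = ℕ.≰⇒> (ℕ.<⇒≱ p ∘ to (g₀ _)) ∷ pos⇒ ps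

  pos⇐ : ∀ {k} (a : Vec ℕ k) → VecAll.All (1 ≤_) (Vec.map g a) → VecAll.All (1 ≤_) a
  pos⇐ []      []       = []
  pos⇐ (_ ∷ a) (p ∷ ps) = ℕ.≰⇒> (ℕ.<⇒≱ p ∘ from (g₀ _)) ∷ pos⇐ a ps

  below⇒ : ∀ {k bs} {v u : Vec ℕ k} → VecPointwise.Pointwise (GaloisAt g) v u →
           ListPointwise.Pointwise _≤_ bs (toList u) → ListPointwise.Pointwise _≤_ (List.map g bs) (toList v)
  below⇒ []       []       = []
  below⇒ (e ∷ es) (p ∷ ps) = from (e _) p ∷ below⇒ es ps

  below⇐ : ∀ {k bs} {v u : Vec ℕ k} → VecPointwise.Pointwise (GaloisAt g) v u →
           ListPointwise.Pointwise _≤_ (List.map g bs) (toList v) → ListPointwise.Pointwise _≤_ bs (toList u)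
  below⇐ {bs = []}    []       []       = []
  below⇐ {bs = _ ∷ _} (e ∷ es) (p ∷ ps) = to (e _) p ∷ below⇐ es ps

-- The index i of the interval (x₁+⋯+xᵢ₋₁, x₁+⋯+xᵢ] that contains l, for
-- 1 ≤ l ≤ x₁+⋯+xₙ; larger l are only required to go above n, monotonically.
block : Vec ℕ n → ℕ → ℕ
block []       l       = l
block (x ∷ xs) zero    = 0
block (x ∷ xs) (suc l) with suc l ℕ.≤? x
... | yes _ = 1
... | no  _ = suc (block xs (suc l ℕ.∸ x))

block≤0 : (x : Vec ℕ n) → GaloisAt (block x) 0 0
block≤0 []       l       = mk⇔ (λ p → p) (λ p → p)
block≤0 (x ∷ xs) zero    = mk⇔ (λ p → p) (λ p → p)
block≤0 (x ∷ xs) (suc l) with suc l ℕ.≤? x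
... | yes _ = mk⇔ (λ ()) (λ ())
... | no  _ = mk⇔ (λ ()) (λ ())

block-mono : (x : Vec ℕ n) → block x Preserves _≤_ ⟶ _≤_
block-mono []       l≤m = l≤m
block-mono (x ∷ xs) {zero}          l≤m = z≤n
block-mono (x ∷ xs) {suc l} {suc m} l≤m with suc l ℕ.≤? x | suc m ℕ.≤? x
... | yes _   | yes _   = ℕ.≤-refl
... | yes _   | no  _   = s≤s z≤n
... | no  l≰x | yes m≤x = contradiction (ℕ.≤-trans l≤m m≤x) l≰x
... | no  _   | no  _   = s≤s (block-mono xs (ℕ.∸-monoˡ-≤ x l≤m))

block-adjoint : (x : Vec ℕ n) →
  VecPointwise.Pointwise (GaloisAt (block x)) (Vec.tabulate {n = n} (suc ∘ toℕ)) (prefixSums ℕ._+_ x)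
block-adjoint []       = []
block-adjoint (x ∷ xs) =
  block≤1 ∷
  subst (λ v → VecPointwise.Pointwise (GaloisAt (block (x ∷ xs))) v (Vec.map (x ℕ.+_) (prefixSums ℕ._+_ xs)))
    (sym (tabulate-∘ suc (suc ∘ toℕ)))
    (VecPointwise.map⁺ (λ {p} {q} → block≤suc {p} {q}) (block-adjoint xs))
  where
  block≤1 : GaloisAt (block (x ∷ xs)) 1 x
  block≤1 zero = mk⇔ (λ _ → z≤n) (λ _ → z≤n)
  block≤1 (suc l) with suc l ℕ.≤? x
  ... | yes l≤x = mk⇔ (λ _ → l≤x) (λ _ → ℕ.≤-refl)
  ... | no  l≰x = mk⇔
    -- Only 0 has block index 0, so the truncated difference vanishes.
    (λ p → ℕ.m∸n≡0⇒m≤n (ℕ.n≤0⇒n≡0 (to (block≤0 xs _) (ℕ.s≤s⁻¹ p))))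
    (λ p → contradiction p l≰x)

  block≤suc : ∀ {p q} → GaloisAt (block xs) p q → GaloisAt (block (x ∷ xs)) (suc p) (x ℕ.+ q)
  block≤suc e zero = mk⇔ (λ _ → z≤n) (λ _ → z≤n)
  block≤suc e (suc l) with suc l ℕ.≤? x
  ... | yes l≤x = mk⇔ (λ _ → ℕ.≤-trans l≤x (ℕ.m≤m+n x _)) (λ _ → s≤s z≤n)
  ... | no  l≰x = mk⇔
    (λ p → ℕ.≤-trans (ℕ.m≤n+m∸n (suc l) x) (ℕ.+-monoʳ-≤ x (to (e _) (ℕ.s≤s⁻¹ p))))
    (λ p → s≤s (from (e _) (ℕ.m≤n+o⇒m∸n≤o (suc l) x p)))

xParking⇔parking-block : (x a : Vec ℕ n) → IsXParkingFunction x a ⇔ IsParkingFunction (Vec.map (block x) a)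
xParking⇔parking-block x = rearrangesBelow-map (block-mono x) (block≤0 x) (block-adjoint x)

-- Identifies the letters 1 and 2.
collapse : ℕ → ℕ
collapse 0             = 0
collapse 1             = 1
collapse (suc (suc l)) = suc l

collapse-mono : collapse Preserves _≤_ ⟶ _≤_
collapse-mono {0}                       _              = z≤n
collapse-mono {1}             {1}       _              = ℕ.≤-refl
collapse-mono {1}   {suc (suc _)}       _              = s≤s z≤n
collapse-mono {suc (suc _)} {suc (suc _)} (s≤s l≤m)    = l≤m

collapse≤0 : GaloisAt collapse 0 0
collapse≤0 0             = mk⇔ (λ p → p) (λ p → p)
collapse≤0 1             = mk⇔ (λ ()) (λ ())
collapse≤0 (suc (suc _)) = mk⇔ (λ ()) (λ ())

collapse≤suc : ∀ i → GaloisAt collapse (suc i) (suc (suc i))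
collapse≤suc i 0             = mk⇔ (λ _ → z≤n) (λ _ → z≤n)
collapse≤suc i 1             = mk⇔ (λ _ → s≤s z≤n) (λ _ → s≤s z≤n)
collapse≤suc i (suc (suc _)) = mk⇔ s≤s ℕ.s≤s⁻¹

-- The letter 1 comes first in sorted order and uses up the bound 1. What remains must lie below 2,
-- 3, ..., n + 1, and these are the upper adjoint values of `collapse` at 1, 2, ..., n.
parking-1∷⇔parking-collapse : (b : Vec ℕ n) →
  IsParkingFunction (1 ∷ b) ⇔ IsParkingFunction (Vec.map collapse b)
parking-1∷⇔parking-collapse {n} b = mk⇔
  (λ { (_ ∷ pos , below) → to below⇔ (pos ,
    tail (subst (λ xs → ListPointwise.Pointwise _≤_ xs _) (sort-∷ (VecAll.toList⁺ pos)) below)) })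
  (λ park → let pos , below = from below⇔ park in
    s≤s z≤n ∷ pos ,
    subst (λ xs → ListPointwise.Pointwise _≤_ xs _) (sym (sort-∷ (VecAll.toList⁺ pos))) (s≤s z≤n ∷ below))
  where
  below⇔ : RearrangesBelow (Vec.tabulate (λ i → suc (suc (toℕ i)))) b ⇔ IsParkingFunction (Vec.map collapse b)
  below⇔ = rearrangesBelow-map collapse-mono collapse≤0 (VecPointwise.tabulate⁺ (λ i → collapse≤suc (toℕ i))) b

  tail : ∀ {x y} {xs ys : List ℕ} → ListPointwise.Pointwise _≤_ (x ∷ xs) (y ∷ ys) → ListPointwise.Pointwise _≤_ xs ys
  tail (_ ∷ ps) = ps

parking⇒∃≤1 : {a : Vec ℕ (suc n)} → IsParkingFunction a → ListAny.Any (_≤ 1) (toList a)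
parking⇒∃≤1 {a = a} (_ , below) = Perm.Any-resp-↭ (sort-↭ (toList a)) (first below)
  where
  first : ∀ {xs ys} → ListPointwise.Pointwise _≤_ xs (1 ∷ ys) → ListAny.Any (_≤ 1) xs
  first (p ∷ _) = here p

parking-[] : IsParkingFunction []
parking-[] = [] , subst (λ xs → ListPointwise.Pointwise _≤_ xs []) (sym (sort-unique {[]} ↭-refl (Sorted.AllPairs⇒Sorted ℕ.≤-totalOrder []))) []

-- The embedding of ℕ in ℚ and ordered arithmetic

fromℕ-homo-+ : ∀ m n → fromℕ (m ℕ.+ n) ≡ fromℕ m + fromℕ n
fromℕ-homo-+ m n = ℚ.toℚᵘ-injective (begin
  ℚ.toℚᵘ (fromℕ (m ℕ.+ n))                 ≈⟨ ℚ.toℚᵘ-fromℚᵘ (mkℚᵘ (ℤ.+ (m ℕ.+ n)) 0) ⟩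
  mkℚᵘ (ℤ.+ (m ℕ.+ n)) 0                      ≈⟨ *≡* (cong (ℤ._* ℤ.+ 1) (sym (cong₂ ℤ._+_ (ℤ.*-identityʳ (ℤ.+ m)) (ℤ.*-identityʳ (ℤ.+ n))))) ⟩
  mkℚᵘ (ℤ.+ m) 0 ℚᵘ.+ mkℚᵘ (ℤ.+ n) 0           ≈⟨ ℚᵘ.+-cong (ℚ.toℚᵘ-fromℚᵘ (mkℚᵘ (ℤ.+ m) 0)) (ℚ.toℚᵘ-fromℚᵘ (mkℚᵘ (ℤ.+ n) 0)) ⟨
  ℚ.toℚᵘ (fromℕ m) ℚᵘ.+ ℚ.toℚᵘ (fromℕ n)  ≈⟨ ℚ.toℚᵘ-homo-+ (fromℕ m) (fromℕ n) ⟨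
  ℚ.toℚᵘ (fromℕ m + fromℕ n)               ∎)
  where open ℚᵘ.≃-Reasoning

fromℕ-homo-* : ∀ m n → fromℕ (m ℕ.* n) ≡ fromℕ m * fromℕ n
fromℕ-homo-* m n = ℚ.toℚᵘ-injective (begin
  ℚ.toℚᵘ (fromℕ (m ℕ.* n))                 ≈⟨ ℚ.toℚᵘ-fromℚᵘ (mkℚᵘ (ℤ.+ (m ℕ.* n)) 0) ⟩
  mkℚᵘ (ℤ.+ (m ℕ.* n)) 0                      ≈⟨ *≡* (cong (ℤ._* ℤ.+ 1) (ℤ.pos-* m n)) ⟩
  mkℚᵘ (ℤ.+ m) 0 ℚᵘ.* mkℚᵘ (ℤ.+ n) 0           ≈⟨ ℚᵘ.*-cong (ℚ.toℚᵘ-fromℚᵘ (mkℚᵘ (ℤ.+ m) 0)) (ℚ.toℚᵘ-fromℚᵘ (mkℚᵘ (ℤ.+ n) 0)) ⟨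
  ℚ.toℚᵘ (fromℕ m) ℚᵘ.* ℚ.toℚᵘ (fromℕ n)  ≈⟨ ℚ.toℚᵘ-homo-* (fromℕ m) (fromℕ n) ⟨
  ℚ.toℚᵘ (fromℕ m * fromℕ n)               ∎)
  where open ℚᵘ.≃-Reasoning

fromℕ-injective : ∀ {m n} → fromℕ m ≡ fromℕ n → m ≡ n
fromℕ-injective {m} {n} eq with ℚ.fromℚᵘ-injective {mkℚᵘ (ℤ.+ m) 0} {mkℚᵘ (ℤ.+ n) 0} eq
... | *≡* eq′ = ℤ.+-injective (trans (sym (ℤ.*-identityʳ (ℤ.+ m))) (trans eq′ (ℤ.*-identityʳ (ℤ.+ n))))

fromℕ-nonNeg : ∀ n → 0ℚ ℚ.≤ fromℕ n
fromℕ-nonNeg n = ℚ.nonNegative⁻¹ (fromℕ n) {{ℚ.normalize-nonNeg n 1}}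

*-monoʳ : ∀ {p q r} → 0ℚ ℚ.≤ p → q ℚ.≤ r → p * q ℚ.≤ p * r
*-monoʳ {p} 0≤p = ℚ.*-monoˡ-≤-nonNeg p {{ℚ.nonNegative 0≤p}}

*-monoˡ : ∀ {p q r} → 0ℚ ℚ.≤ p → q ℚ.≤ r → q * p ℚ.≤ r * p
*-monoˡ {p} 0≤p = ℚ.*-monoʳ-≤-nonNeg p {{ℚ.nonNegative 0≤p}}

*-nonNeg : ∀ {p q} → 0ℚ ℚ.≤ p → 0ℚ ℚ.≤ q → 0ℚ ℚ.≤ p * q
*-nonNeg {p} 0≤p 0≤q = ℚ.≤-trans (ℚ.≤-reflexive (sym (ℚ.*-zeroʳ p))) (*-monoʳ 0≤p 0≤q)

+-nonNeg : ∀ {p q} → 0ℚ ℚ.≤ p → 0ℚ ℚ.≤ q → 0ℚ ℚ.≤ p + q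
+-nonNeg 0≤p 0≤q = ℚ.+-mono-≤ 0≤p 0≤q

-- Weighted sums over words

-- h 1 + ⋯ + h k: letters count from 1.
∑ : ℕ → (ℕ → ℚ) → ℚ
∑ k h = sumᶠ {k} (λ i → h (suc (toℕ i)))

∑-cong : ∀ k {h h′ : ℕ → ℚ} → (∀ l → h l ≡ h′ l) → ∑ k h ≡ ∑ k h′
∑-cong k eq = sum-cong-≗ {k} (λ i → eq (suc (toℕ i)))

∑-linear : ∀ k c (f g : ℕ → ℚ) → ∑ k (λ l → f l + c * g l) ≡ ∑ k f + c * ∑ k g
∑-linear k c f g = trans
  (∑-distrib-+ {k} (λ i → f (suc (toℕ i))) (λ i → c * g (suc (toℕ i))))
  (cong (∑ k f +_) (sym (*-distribˡ-sum {k} c (λ i → g (suc (toℕ i))))))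

∑-mono : ∀ k {h h′ : ℕ → ℚ} → (∀ l → h l ℚ.≤ h′ l) → ∑ k h ℚ.≤ ∑ k h′
∑-mono zero    le = ℚ.≤-refl
∑-mono (suc k) le = ℚ.+-mono-≤ (le 1) (∑-mono k (λ l → le (suc l)))

∑-zero : ∀ k {h : ℕ → ℚ} → (∀ l → h l ≡ 0ℚ) → ∑ k h ≡ 0ℚ
∑-zero k eq = trans (∑-cong k eq) (sum-replicate-zero k)

-- The integral of `f` against the n-fold product of the weight `w` on the letters 1, ..., k,
-- written as an iterated sum so that weights can be changed one position at a time.
wordSum : ℕ → (ℕ → ℚ) → ∀ n → (Vec ℕ n → ℚ) → ℚ
wordSum k w zero    f = f []
wordSum k w (suc n) f = ∑ k (λ l → w l * wordSum k w n (λ a → f (l ∷ a)))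

wordSum-cong : ∀ k w n {f g : Vec ℕ n → ℚ} → (∀ a → f a ≡ g a) → wordSum k w n f ≡ wordSum k w n g
wordSum-cong k w zero    eq = eq []
wordSum-cong k w (suc n) eq = ∑-cong k (λ l → cong (w l *_) (wordSum-cong k w n (λ a → eq (l ∷ a))))

wordSum-nonNeg : ∀ k {w} → (∀ l → 0ℚ ℚ.≤ w l) → ∀ n {f : Vec ℕ n → ℚ} → (∀ a → 0ℚ ℚ.≤ f a) →
                 0ℚ ℚ.≤ wordSum k w n f
wordSum-nonNeg k 0≤w zero    0≤f = 0≤f []
wordSum-nonNeg k 0≤w (suc n) 0≤f =
  ℚ.≤-trans (ℚ.≤-reflexive (sym (∑-zero k {λ _ → 0ℚ} (λ _ → refl))))
    (∑-mono k (λ l → *-nonNeg (0≤w l) (wordSum-nonNeg k 0≤w n (λ a → 0≤f (l ∷ a)))))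

wordSum-mono : ∀ k {w w′} → (∀ l → 0ℚ ℚ.≤ w l) → (∀ l → w l ℚ.≤ w′ l) →
               ∀ n {f : Vec ℕ n → ℚ} → (∀ a → 0ℚ ℚ.≤ f a) → wordSum k w n f ℚ.≤ wordSum k w′ n f
wordSum-mono k 0≤w w≤w′ zero    0≤f = ℚ.≤-refl
wordSum-mono k 0≤w w≤w′ (suc n) 0≤f = ∑-mono k (λ l → ℚ.≤-trans
  (*-monoˡ (wordSum-nonNeg k 0≤w n (λ a → 0≤f (l ∷ a))) (w≤w′ l))
  (*-monoʳ (ℚ.≤-trans (0≤w l) (w≤w′ l)) (wordSum-mono k 0≤w w≤w′ n (λ a → 0≤f (l ∷ a)))))

-- Change of variables for product weights. That `g` pushes `w` forward to `v` is expressed through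
-- test functions `h`, which avoids describing the fibres of `g`.
wordSum-pushforward : ∀ k m {w v} {g : ℕ → ℕ} →
  (∀ (h : ℕ → ℚ) → ∑ k (λ l → w l * h (g l)) ≡ ∑ m (λ l → v l * h l)) →
  ∀ n (f : Vec ℕ n → ℚ) → wordSum k w n (λ a → f (Vec.map g a)) ≡ wordSum m v n f
wordSum-pushforward k m                 push zero    f = refl
wordSum-pushforward k m {w} {v} {g} push (suc n) f = trans
  (∑-cong k (λ l → cong (w l *_) (wordSum-pushforward k m {w} {v} {g} push n (λ a → f (g l ∷ a)))))
  (push (λ l → wordSum m v n (λ a → f (l ∷ a))))

wordSum-zero : ∀ k {w} n {f : Vec ℕ n → ℚ} →
  (∀ a → ListAny.Any (λ l → w l ≡ 0ℚ) (toList a) ⊎ f a ≡ 0ℚ) → wordSum k w n f ≡ 0ℚ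
wordSum-zero k     zero    vanish with vanish []
... | inj₂ eq = eq
wordSum-zero k {w} (suc n) {f} vanish = ∑-zero k term
  where
  term : ∀ l → w l * wordSum k w n (λ a → f (l ∷ a)) ≡ 0ℚ
  term l with w l ℚ.≟ 0ℚ
  ... | yes eq = trans (cong (_* wordSum k w n (λ a → f (l ∷ a))) eq) (ℚ.*-zeroˡ (wordSum k w n (λ a → f (l ∷ a))))
  ... | no  ne = trans (cong (w l *_) (wordSum-zero k n rest)) (ℚ.*-zeroʳ (w l))
    where
    rest : ∀ a → ListAny.Any (λ l → w l ≡ 0ℚ) (toList a) ⊎ f (l ∷ a) ≡ 0ℚ
    rest a with vanish (l ∷ a)
    ... | inj₁ (here eq)   = contradiction eq ne
    ... | inj₁ (there any) = inj₁ any
    ... | inj₂ eq          = inj₂ eq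

Symmetric : (Vec ℕ n → ℚ) → Set
Symmetric f = ∀ a b → toList a ↭ toList b → f a ≡ f b

fromℕ-suc : ∀ n → fromℕ (suc n) ≡ 1ℚ + fromℕ n
fromℕ-suc = fromℕ-homo-+ 1

-- As weights on 1, ..., k, `w′` is `w` plus a point mass `d` at the letter 1, again expressed
-- through test functions.
ShiftsAt1 : ℕ → (w w′ : ℕ → ℚ) → ℚ → Set
ShiftsAt1 k w w′ d = ∀ (h : ℕ → ℚ) → ∑ k (λ l → w′ l * h l) ≡ ∑ k (λ l → w l * h l) + d * h 1

shift-linear : ∀ k {w w′ d} → ShiftsAt1 k w w′ d → ∀ c (f g : ℕ → ℚ) →
  ∑ k (λ l → w′ l * (f l + c * (d * g l))) ≡
  ∑ k (λ l → w l * f l) + d * f 1 + c * (d * ∑ k (λ l → w′ l * g l))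
shift-linear k {w} {w′} {d} shift c f g = begin
  ∑ k (λ l → w′ l * (f l + c * (d * g l)))
    ≡⟨ ∑-cong k (λ l →
         solve 5 (λ w f c d g → w :* (f :+ c :* (d :* g)) := w :* f :+ (c :* d) :* (w :* g)) refl
           (w′ l) (f l) c d (g l)) ⟩
  ∑ k (λ l → w′ l * f l + (c * d) * (w′ l * g l))
    ≡⟨ ∑-linear k (c * d) (λ l → w′ l * f l) (λ l → w′ l * g l) ⟩
  ∑ k (λ l → w′ l * f l) + (c * d) * ∑ k (λ l → w′ l * g l)
    ≡⟨ cong₂ _+_ (shift f) (ℚ.*-assoc c d _) ⟩
  ∑ k (λ l → w l * f l) + d * f 1 + c * (d * ∑ k (λ l → w′ l * g l)) ∎
  where open ≡-Reasoning

regroup : ∀ x d t n → x + d * t + fromℕ n * (d * t) ≡ x + fromℕ (suc n) * (d * t)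
regroup x d t n = trans
  (solve 4 (λ x d t c → x :+ d :* t :+ c :* (d :* t) := x :+ (con 1ℚ :+ c) :* (d :* t)) refl x d t (fromℕ n))
  (cong (λ c → x + c * (d * t)) (sym (fromℕ-suc n)))

-- The derivative of a word sum in the weight of the letter 1, with an increment
-- d in place of the differential: by symmetry the letter may be taken first.
module _ {k : ℕ} {w w′ : ℕ → ℚ} {d : ℚ} (0≤w : ∀ l → 0ℚ ℚ.≤ w l)
  (w≤w′ : ∀ l → w l ℚ.≤ w′ l) (0≤d : 0ℚ ℚ.≤ d) (shift : ShiftsAt1 k w w′ d) where

  -- Replacing `w` by `w′` position by position gives n + 1 increments, each with one letter fixed
  -- to 1 and a mixture of `w` and `w′` elsewhere. Using `w′` everywhere bounds them from above,
  -- using `w` everywhere from below.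
  wordSum-shift-≤ : ∀ n {f : Vec ℕ (suc n) → ℚ} → Symmetric f → (∀ a → 0ℚ ℚ.≤ f a) →
    wordSum k w′ (suc n) f ℚ.≤
    wordSum k w (suc n) f + fromℕ (suc n) * (d * wordSum k w′ n (λ a → f (1 ∷ a)))
  wordSum-shift-≤ zero {f} sym-f 0≤f = ℚ.≤-reflexive (trans (shift (λ l → f (l ∷ [])))
    (cong (∑ k (λ l → w l * f (l ∷ [])) +_) (sym (ℚ.*-identityˡ (d * f (1 ∷ []))))))
  wordSum-shift-≤ (suc n) {f} sym-f 0≤f = begin
    ∑ k (λ l → w′ l * wordSum k w′ (suc n) (λ a → f (l ∷ a)))
      ≤⟨ ∑-mono k (λ l → *-monoʳ (ℚ.≤-trans (0≤w l) (w≤w′ l))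
           (wordSum-shift-≤ n {λ a → f (l ∷ a)} (λ a b a↭b → sym-f (l ∷ a) (l ∷ b) (↭-prep l a↭b)) (λ a → 0≤f (l ∷ a)))) ⟩
    ∑ k (λ l → w′ l * (W l + c * (d * wordSum k w′ n (λ a → f (l ∷ 1 ∷ a)))))
      ≡⟨ shift-linear k {w} {w′} {d} shift c W (λ l → wordSum k w′ n (λ a → f (l ∷ 1 ∷ a))) ⟩
    X + d * W 1 + c * (d * ∑ k (λ l → w′ l * wordSum k w′ n (λ a → f (l ∷ 1 ∷ a))))
      ≡⟨ cong (λ t → X + d * W 1 + c * (d * t))
           (∑-cong k (λ l → cong (w′ l *_) (wordSum-cong k w′ n (λ a →
              sym-f (l ∷ 1 ∷ a) (1 ∷ l ∷ a) (↭-swap l 1 ↭-refl))))) ⟩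
    X + d * W 1 + c * (d * T)
      -- The increment at the first position still carries `w` on the other letters; raising it to
      -- `w′` yields one more copy of `T`.
      ≤⟨ ℚ.+-monoˡ-≤ (c * (d * T)) (ℚ.+-monoʳ-≤ X (*-monoʳ 0≤d (wordSum-mono k 0≤w w≤w′ (suc n) (λ a → 0≤f (1 ∷ a))))) ⟩
    X + d * T + c * (d * T)
      ≡⟨ regroup X d T (suc n) ⟩
    X + fromℕ (suc (suc n)) * (d * T) ∎
    where
    open ℚ.≤-Reasoning
    c = fromℕ (suc n)
    W = λ l → wordSum k w (suc n) (λ a → f (l ∷ a))
    X = wordSum k w (suc (suc n)) f
    T = wordSum k w′ (suc n) (λ a → f (1 ∷ a))

  wordSum-shift-≥ : ∀ n {f : Vec ℕ (suc n) → ℚ} → Symmetric f → (∀ a → 0ℚ ℚ.≤ f a) →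
    wordSum k w (suc n) f + fromℕ (suc n) * (d * wordSum k w n (λ a → f (1 ∷ a))) ℚ.≤
    wordSum k w′ (suc n) f
  wordSum-shift-≥ zero {f} sym-f 0≤f = ℚ.≤-reflexive (sym (trans (shift (λ l → f (l ∷ [])))
    (cong (∑ k (λ l → w l * f (l ∷ [])) +_) (sym (ℚ.*-identityˡ (d * f (1 ∷ [])))))))
  wordSum-shift-≥ (suc n) {f} sym-f 0≤f = begin
    X + fromℕ (suc (suc n)) * (d * W 1)
      ≡⟨ regroup X d (W 1) (suc n) ⟨
    X + d * W 1 + c * (d * W 1)
      ≡⟨ cong (λ t → X + d * W 1 + c * (d * t))
           (∑-cong k (λ l → cong (w l *_) (wordSum-cong k w n (λ a →
              sym-f (1 ∷ l ∷ a) (l ∷ 1 ∷ a) (↭-swap 1 l ↭-refl))))) ⟩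
    X + d * W 1 + c * (d * ∑ k (λ l → w l * B l))
      -- The first letter is raised to `w′`, so that the whole expression becomes a single sum
      -- weighted by `w′`.
      ≤⟨ ℚ.+-monoʳ-≤ (X + d * W 1) (*-monoʳ (fromℕ-nonNeg (suc n)) (*-monoʳ 0≤d
           (∑-mono k (λ l → *-monoˡ (wordSum-nonNeg k 0≤w n (λ a → 0≤f (l ∷ 1 ∷ a))) (w≤w′ l))))) ⟩
    X + d * W 1 + c * (d * ∑ k (λ l → w′ l * B l))
      ≡⟨ shift-linear k {w} {w′} {d} shift c W B ⟨
    ∑ k (λ l → w′ l * (W l + c * (d * B l)))
      ≤⟨ ∑-mono k (λ l → *-monoʳ (ℚ.≤-trans (0≤w l) (w≤w′ l))
           (wordSum-shift-≥ n {λ a → f (l ∷ a)} (λ a b a↭b → sym-f (l ∷ a) (l ∷ b) (↭-prep l a↭b)) (λ a → 0≤f (l ∷ a)))) ⟩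
    ∑ k (λ l → w′ l * wordSum k w′ (suc n) (λ a → f (l ∷ a))) ∎
    where
    open ℚ.≤-Reasoning
    c = fromℕ (suc n)
    W = λ l → wordSum k w (suc n) (λ a → f (l ∷ a))
    B = λ l → wordSum k w n (λ a → f (l ∷ 1 ∷ a))
    X = wordSum k w (suc (suc n)) f

∑-cong-≤ : ∀ k {h h′ : ℕ → ℚ} → (∀ l → suc l ≤ k → h (suc l) ≡ h′ (suc l)) → ∑ k h ≡ ∑ k h′
∑-cong-≤ k eq = sum-cong-≗ {k} (λ i → eq (toℕ i) (toℕ<n i))

∑-+ : ∀ k m (h : ℕ → ℚ) → ∑ (k ℕ.+ m) h ≡ ∑ k h + ∑ m (λ l → h (k ℕ.+ l))
∑-+ zero    m h = sym (ℚ.+-identityˡ (∑ m h))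
∑-+ (suc k) m h = trans (cong (h 1 +_) (∑-+ k m (h ∘ suc))) (sym (ℚ.+-assoc (h 1) _ _))

∑-const : ∀ k c → ∑ k (λ _ → c) ≡ fromℕ k * c
∑-const zero    c = sym (ℚ.*-zeroˡ c)
∑-const (suc k) c = begin
  c + ∑ k (λ _ → c)    ≡⟨ cong (c +_) (∑-const k c) ⟩
  c + fromℕ k * c      ≡⟨ solve 2 (λ c k → c :+ k :* c := (con 1ℚ :+ k) :* c) refl c (fromℕ k) ⟩
  (1ℚ + fromℕ k) * c   ≡⟨ cong (_* c) (fromℕ-suc k) ⟨
  fromℕ (suc k) * c    ∎
  where open ≡-Reasoning

-- From sums over enumerated lists to word sums

sumOver : (A → ℚ) → List A → ℚ
sumOver h xs = List.foldr _+_ 0ℚ (List.map h xs)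

sumOver-cong : ∀ {h h′ : A → ℚ} → (∀ a → h a ≡ h′ a) → ∀ xs → sumOver h xs ≡ sumOver h′ xs
sumOver-cong eq []       = refl
sumOver-cong eq (x ∷ xs) = cong₂ _+_ (eq x) (sumOver-cong eq xs)

sumOver-* : ∀ c (h : A → ℚ) xs → sumOver (λ a → c * h a) xs ≡ c * sumOver h xs
sumOver-* c h []       = sym (ℚ.*-zeroʳ c)
sumOver-* c h (x ∷ xs) =
  trans (cong (c * h x +_) (sumOver-* c h xs)) (sym (ℚ.*-distribˡ-+ c (h x) (sumOver h xs)))

sumOver-++ : ∀ (h : A → ℚ) xs ys → sumOver h (xs List.++ ys) ≡ sumOver h xs + sumOver h ys
sumOver-++ h []       ys = sym (ℚ.+-identityˡ _)
sumOver-++ h (x ∷ xs) ys = trans (cong (h x +_) (sumOver-++ h xs ys)) (sym (ℚ.+-assoc (h x) _ _))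

sumOver-map : ∀ {B : Set} (h : B → ℚ) (g : A → B) xs → sumOver h (List.map g xs) ≡ sumOver (λ a → h (g a)) xs
sumOver-map h g []       = refl
sumOver-map h g (x ∷ xs) = cong (h (g x) +_) (sumOver-map h g xs)

sumOver-cartesianProductWith : ∀ {B C : Set} (h : C → ℚ) (g : A → B → C) xs ys →
  sumOver h (List.cartesianProductWith g xs ys) ≡ sumOver (λ a → sumOver (λ b → h (g a b)) ys) xs
sumOver-cartesianProductWith h g []       ys = refl
sumOver-cartesianProductWith h g (x ∷ xs) ys = trans
  (sumOver-++ h (List.map (g x) ys) _)
  (cong₂ _+_ (sumOver-map h (g x) ys) (sumOver-cartesianProductWith h g xs ys))

sumOver-applyUpTo : ∀ (h : A → ℚ) (f : ℕ → A) k → sumOver h (List.applyUpTo f k) ≡ sumᶠ {k} (λ i → h (f (toℕ i)))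
sumOver-applyUpTo h f zero    = refl
sumOver-applyUpTo h f (suc k) = cong (h (f 0) +_) (sumOver-applyUpTo h (f ∘ suc) k)

indicator : ∀ {P : Set} → Dec P → ℚ
indicator p? = if does p? then 1ℚ else 0ℚ

indicator-cong : ∀ {P Q : Set} → P ⇔ Q → (p? : Dec P) (q? : Dec Q) → indicator p? ≡ indicator q?
indicator-cong P⇔Q p? q? = cong (if_then 1ℚ else 0ℚ) (does-⇔ P⇔Q p? q?)

indicator-nonNeg : ∀ {P : Set} (p? : Dec P) → 0ℚ ℚ.≤ indicator p?
indicator-nonNeg (yes _) = ℚ.<⇒≤ (ℚ.positive⁻¹ 1ℚ)
indicator-nonNeg (no _)  = ℚ.≤-refl

sumOver-filter : ∀ {P : A → Set} (P? : Decidable P) (h : A → ℚ) xs →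
  sumOver h (List.filter P? xs) ≡ sumOver (λ a → h a * indicator (P? a)) xs
sumOver-filter P? h [] = refl
sumOver-filter P? h (x ∷ xs) with does (P? x)
... | true  = cong₂ _+_ (sym (ℚ.*-identityʳ (h x))) (sumOver-filter P? h xs)
... | false = begin
  sumOver h (List.filter P? xs)                               ≡⟨ sumOver-filter P? h xs ⟩
  sumOver (λ a → h a * indicator (P? a)) xs                   ≡⟨ ℚ.+-identityˡ _ ⟨
  0ℚ + sumOver (λ a → h a * indicator (P? a)) xs              ≡⟨ cong (_+ sumOver (λ a → h a * indicator (P? a)) xs) (ℚ.*-zeroʳ (h x)) ⟨
  h x * 0ℚ + sumOver (λ a → h a * indicator (P? a)) xs        ∎
  where open ≡-Reasoning

wordWeight : (ℕ → ℚ) → Vec ℕ n → ℚ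
wordWeight w a = Vec.foldr′ _*_ 1ℚ (Vec.map w a)

sumOver-words : ∀ k w n (f : Vec ℕ n → ℚ) →
  sumOver (λ a → wordWeight w a * f a) (words (List.map suc (upTo k)) n) ≡ wordSum k w n f
sumOver-words k w zero    f = trans (ℚ.+-identityʳ (1ℚ * f [])) (ℚ.*-identityˡ (f []))
sumOver-words k w (suc n) f = begin
  sumOver (λ a → wordWeight w a * f a) (List.cartesianProductWith _∷_ letters (words letters n))
    ≡⟨ sumOver-cartesianProductWith (λ a → wordWeight w a * f a) _∷_ letters (words letters n) ⟩
  sumOver (λ l → sumOver (λ a → w l * wordWeight w a * f (l ∷ a)) (words letters n)) letters
    ≡⟨ sumOver-cong first letters ⟩
  sumOver (λ l → w l * wordSum k w n (λ a → f (l ∷ a))) letters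
    ≡⟨ sumOver-map _ suc (upTo k) ⟩
  sumOver (λ l → w (suc l) * wordSum k w n (λ a → f (suc l ∷ a))) (upTo k)
    ≡⟨ sumOver-applyUpTo (λ l → w (suc l) * wordSum k w n (λ a → f (suc l ∷ a))) id k ⟩
  wordSum k w (suc n) f ∎
  where
  open ≡-Reasoning
  letters = List.map suc (upTo k)

  first : ∀ l → sumOver (λ a → w l * wordWeight w a * f (l ∷ a)) (words letters n) ≡
                w l * wordSum k w n (λ a → f (l ∷ a))
  first l = begin
    sumOver (λ a → w l * wordWeight w a * f (l ∷ a)) (words letters n)
      ≡⟨ sumOver-cong (λ a → ℚ.*-assoc (w l) (wordWeight w a) (f (l ∷ a))) (words letters n) ⟩
    sumOver (λ a → w l * (wordWeight w a * f (l ∷ a))) (words letters n)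
      ≡⟨ sumOver-* (w l) (λ a → wordWeight w a * f (l ∷ a)) (words letters n) ⟩
    w l * sumOver (λ a → wordWeight w a * f (l ∷ a)) (words letters n)
      ≡⟨ cong (w l *_) (sumOver-words k w n (λ a → f (l ∷ a))) ⟩
    w l * wordSum k w n (λ a → f (l ∷ a)) ∎

-- The size of the enumerated alphabet is a maximum of bounds; the equation lets it be replaced by n
-- or by x₁ + ⋯ + xₙ.
sumOver-allBelow : ∀ w (u : Vec ℕ n) {k} → max 0 (toList u) ≡ k →
  sumOver (wordWeight w) (allBelow u) ≡ wordSum k w n (λ a → indicator (rearrangesBelow? u a))
sumOver-allBelow {n} w u refl =
  trans (sumOver-filter (rearrangesBelow? u) (wordWeight w) (words _ n)) (sumOver-words _ w n _)

max-prefixSums : (x : Vec ℕ n) → max 0 (toList (prefixSums ℕ._+_ x)) ≡ Vec.sum x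
max-prefixSums x = ℕ.≤-antisym
  (max≤v⁺ z≤n (VecAll.toList⁺ (below x)))
  (v≤max⁺ 0 _ (attained x))
  where
  below : ∀ {n} (x : Vec ℕ n) → VecAll.All (_≤ Vec.sum x) (prefixSums ℕ._+_ x)
  below []       = []
  below (x ∷ xs) = ℕ.m≤m+n x _ ∷ VecAll.map⁺ (VecAll.map (ℕ.+-monoʳ-≤ x) (below xs))

  attained : ∀ {n} (x : Vec ℕ n) →
             Vec.sum x ≤ 0 ⊎ ListAny.Any (Vec.sum x ≤_) (toList (prefixSums ℕ._+_ x))
  attained []       = inj₁ z≤n
  attained (x ∷ xs) = inj₂ (VecAny.toList⁺ (last x xs))
    where
    last : ∀ {n} x (xs : Vec ℕ n) → VecAny.Any (x ℕ.+ Vec.sum xs ≤_) (prefixSums ℕ._+_ (x ∷ xs))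
    last x []       = here (ℕ.≤-reflexive (ℕ.+-identityʳ x))
    last x (y ∷ ys) = there (VecAny.map⁺ (VecAny.map (ℕ.+-monoʳ-≤ x) (last y ys)))

-- Parking functions are the case x = (1, ..., 1), so their largest bound is an instance of
-- `max-prefixSums`.
tabulate-suc≡prefixSums : ∀ n → Vec.tabulate (suc ∘ toℕ) ≡ prefixSums ℕ._+_ (Vec.replicate n 1)
tabulate-suc≡prefixSums zero    = refl
tabulate-suc≡prefixSums (suc n) =
  cong (1 ∷_) (trans (tabulate-∘ suc (suc ∘ toℕ)) (cong (Vec.map suc) (tabulate-suc≡prefixSums n)))

max-parkingBound : ∀ n → max 0 (toList (Vec.tabulate {n = n} (suc ∘ toℕ))) ≡ n
max-parkingBound n = trans (cong (λ u → max 0 (toList u)) (tabulate-suc≡prefixSums n))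
  (trans (max-prefixSums (Vec.replicate n 1)) (sum-ones n))
  where
  sum-ones : ∀ n → Vec.sum (Vec.replicate n 1) ≡ n
  sum-ones zero    = refl
  sum-ones (suc n) = cong suc (sum-ones n)

weight : Vec ℚ n → ℕ → ℚ
weight []       _             = 0ℚ
weight (x ∷ xs) 0             = 0ℚ
weight (x ∷ xs) 1             = x
weight (x ∷ xs) (suc (suc k)) = weight xs (suc k)

parkingIndicator : ∀ n → Vec ℕ n → ℚ
parkingIndicator n a = indicator (rearrangesBelow? (Vec.tabulate (suc ∘ toℕ)) a)

parkingSum : Vec ℚ n → ℚ
parkingSum {n} x = wordSum n (weight x) n (parkingIndicator n)

sumOver-park : (x : Vec ℚ n) → sumOver (wordWeight (weight x)) (park n) ≡ parkingSum x
sumOver-park {n} x = sumOver-allBelow (weight x) (Vec.tabulate {n = n} (suc ∘ toℕ)) (max-parkingBound n)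

-- Counting x-parking functions by blocks

block-≤ : ∀ x (xs : Vec ℕ n) l → suc l ≤ x → block (x ∷ xs) (suc l) ≡ 1
block-≤ x xs l l<x with suc l ℕ.≤? x
... | yes _   = refl
... | no  l≮x = contradiction l<x l≮x

block-> : ∀ x (xs : Vec ℕ n) l → block (x ∷ xs) (x ℕ.+ suc l) ≡ suc (block xs (suc l))
block-> x xs l rewrite ℕ.+-suc x l with suc (x ℕ.+ l) ℕ.≤? x
... | yes p = contradiction p (ℕ.m+1+n≰m x ∘ subst (_≤ x) (sym (ℕ.+-suc x l)))
... | no  _ = cong (suc ∘ block xs) (trans (cong (ℕ._∸ x) (sym (ℕ.+-suc x l))) (ℕ.m+n∸m≡n x (suc l)))

-- Counting measure on 1, ..., x₁ + ⋯ + xₙ is pushed forward to the weights xᵢ: the first x₁ letters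
-- all go to 1, and the others repeat the argument with indices raised by one. An entry xᵢ = 0 gives
-- an empty block of weight 0.
∑-block : (x : Vec ℕ n) (h : ℕ → ℚ) →
  ∑ (Vec.sum x) (λ l → 1ℚ * h (block x l)) ≡ ∑ n (λ l → weight (Vec.map fromℕ x) l * h l)
∑-block []               h = refl
∑-block {suc n} (x ∷ xs) h = begin
  ∑ (x ℕ.+ Vec.sum xs) f
    ≡⟨ ∑-+ x (Vec.sum xs) f ⟩
  ∑ x f + ∑ (Vec.sum xs) (λ l → f (x ℕ.+ l))
    ≡⟨ cong₂ _+_
         (trans
           (∑-cong-≤ x {f} {λ _ → h 1} (λ l l<x → trans (ℚ.*-identityˡ _) (cong h (block-≤ x xs l l<x))))
           (∑-const x (h 1)))
         (∑-cong-≤ (Vec.sum xs) {λ l → f (x ℕ.+ l)} {λ l → 1ℚ * h (suc (block xs l))}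
           (λ l _ → cong (λ b → 1ℚ * h b) (block-> x xs l))) ⟩
  fromℕ x * h 1 + ∑ (Vec.sum xs) (λ l → 1ℚ * h (suc (block xs l)))
    ≡⟨ cong (fromℕ x * h 1 +_) (∑-block xs (h ∘ suc)) ⟩
  fromℕ x * h 1 + ∑ n (λ l → weight (Vec.map fromℕ xs) l * h (suc l)) ∎
  where
  open ≡-Reasoning
  f = λ l → 1ℚ * h (block (x ∷ xs) l)

fromℕ-P : (x : Vec ℕ n) → fromℕ (P x) ≡ parkingSum (Vec.map fromℕ x)
fromℕ-P {n} x = begin
  fromℕ (P x)
    ≡⟨ count (allBelow (prefixSums ℕ._+_ x)) ⟩
  sumOver (wordWeight (λ _ → 1ℚ)) (allBelow (prefixSums ℕ._+_ x))
    ≡⟨ sumOver-allBelow (λ _ → 1ℚ) (prefixSums ℕ._+_ x) {Vec.sum x} (max-prefixSums x) ⟩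
  wordSum (Vec.sum x) (λ _ → 1ℚ) n (λ a → indicator (rearrangesBelow? (prefixSums ℕ._+_ x) a))
    ≡⟨ wordSum-cong (Vec.sum x) (λ _ → 1ℚ) n (λ a → indicator-cong (xParking⇔parking-block x a)
           (rearrangesBelow? (prefixSums ℕ._+_ x) a)
           (rearrangesBelow? (Vec.tabulate (suc ∘ toℕ)) (Vec.map (block x) a))) ⟩
  wordSum (Vec.sum x) (λ _ → 1ℚ) n (λ a → parkingIndicator n (Vec.map (block x) a))
    ≡⟨ wordSum-pushforward (Vec.sum x) n {λ _ → 1ℚ} {weight (Vec.map fromℕ x)} {block x}
         (∑-block x) n (parkingIndicator n) ⟩
  parkingSum (Vec.map fromℕ x) ∎
  where
  open ≡-Reasoning

  wordWeight-1 : ∀ {k} (a : Vec ℕ k) → wordWeight (λ _ → 1ℚ) a ≡ 1ℚ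
  wordWeight-1 []      = refl
  wordWeight-1 (_ ∷ a) = trans (ℚ.*-identityˡ _) (wordWeight-1 a)

  count : (as : List (Vec ℕ n)) → fromℕ (List.length as) ≡ sumOver (wordWeight (λ _ → 1ℚ)) as
  count []       = refl
  count (a ∷ as) = trans (fromℕ-suc (List.length as)) (cong₂ _+_ (sym (wordWeight-1 a)) (count as))

fromℕ-sum-park : (x : Vec ℕ n) →
  fromℕ (sum (List.map (parkingMonomial x) (park n))) ≡ parkingSum (Vec.map fromℕ x)
fromℕ-sum-park {n} x = trans (homo (park n)) (sumOver-park (Vec.map fromℕ x))
  where
  fromℕ-‼ : ∀ {k} (x : Vec ℕ k) l → fromℕ (x ‼ l) ≡ weight (Vec.map fromℕ x) l
  fromℕ-‼ []       l             = refl
  fromℕ-‼ (x ∷ xs) 0             = refl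
  fromℕ-‼ (x ∷ xs) 1             = refl
  fromℕ-‼ (x ∷ xs) (suc (suc l)) = fromℕ-‼ xs (suc l)

  fromℕ-monomial : ∀ {k} (a : Vec ℕ k) →
    fromℕ (Vec.foldr′ ℕ._*_ 1 (Vec.map (x ‼_) a)) ≡ wordWeight (weight (Vec.map fromℕ x)) a
  fromℕ-monomial []      = refl
  fromℕ-monomial (l ∷ a) = trans (fromℕ-homo-* (x ‼ l) _) (cong₂ _*_ (fromℕ-‼ x l) (fromℕ-monomial a))

  homo : ∀ as → fromℕ (sum (List.map (parkingMonomial x) as)) ≡
                sumOver (wordWeight (weight (Vec.map fromℕ x))) as
  homo []       = refl
  homo (a ∷ as) = trans (fromℕ-homo-+ (parkingMonomial x a) _) (cong₂ _+_ (fromℕ-monomial a) (homo as))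

-- Reduces an inequality to a known one with the same slack, which leaves a ring identity.
≤-by : ∀ {p q r s} → p ℚ.≤ q → q - p ≡ s - r → r ℚ.≤ s
≤-by {p} {q} {r} {s} p≤q eq = begin
  r             ≡⟨ solve 2 (λ p r → r := p :- p :+ r) refl p r ⟩
  p - p + r     ≤⟨ ℚ.+-monoˡ-≤ r (ℚ.+-monoˡ-≤ (ℚ.- p) p≤q) ⟩
  q - p + r     ≡⟨ cong (_+ r) eq ⟩
  s - r + r     ≡⟨ solve 2 (λ s r → s :- r :+ r := s) refl s r ⟩
  s             ∎
  where open ℚ.≤-Reasoning

≤⇒0≤- : ∀ {p q} → p ℚ.≤ q → 0ℚ ℚ.≤ q - p
≤⇒0≤- {p} {q} p≤q = ≤-by p≤q (solve 2 (λ p q → q :- p := q :- p :- con 0ℚ) refl p q)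

-- Reciprocals and inverse factorials

recip : ℕ → ℚ
recip n = ℤ.+ 1 ℚ./ suc n

fromℕ-recip : ∀ n → fromℕ (suc n) * recip n ≡ 1ℚ
fromℕ-recip n = ℚ.toℚᵘ-injective (begin
  ℚ.toℚᵘ (fromℕ (suc n) * recip n)               ≈⟨ ℚ.toℚᵘ-homo-* (fromℕ (suc n)) (recip n) ⟩
  ℚ.toℚᵘ (fromℕ (suc n)) ℚᵘ.* ℚ.toℚᵘ (recip n)  ≈⟨ ℚᵘ.*-cong (ℚ.toℚᵘ-fromℚᵘ (mkℚᵘ (ℤ.+ suc n) 0)) (ℚ.toℚᵘ-fromℚᵘ (mkℚᵘ (ℤ.+ 1) n)) ⟩
  mkℚᵘ (ℤ.+ suc n) 0 ℚᵘ.* mkℚᵘ (ℤ.+ 1) n         ≈⟨ ℚᵘ.*-inverseʳ (mkℚᵘ (ℤ.+ suc n) 0) ⟩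
  ℚ.toℚᵘ 1ℚ                                      ∎)
  where open ℚᵘ.≃-Reasoning

recip-pos : ∀ n → 0ℚ ℚ.< recip n
recip-pos n = ℚ.positive⁻¹ (recip n) {{ℚ.normalize-pos 1 (suc n)}}

invFact : ℕ → ℚ
invFact zero    = 1ℚ
invFact (suc n) = recip n * invFact n

invFact-nonNeg : ∀ n → 0ℚ ℚ.≤ invFact n
invFact-nonNeg zero    = ℚ.<⇒≤ (ℚ.positive⁻¹ 1ℚ)
invFact-nonNeg (suc n) = *-nonNeg (ℚ.<⇒≤ (recip-pos n)) (invFact-nonNeg n)

fromℕ-invFact-suc : ∀ n → fromℕ (suc n) * invFact (suc n) ≡ invFact n
fromℕ-invFact-suc n = begin
  fromℕ (suc n) * (recip n * invFact n)   ≡⟨ ℚ.*-assoc (fromℕ (suc n)) (recip n) (invFact n) ⟨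
  fromℕ (suc n) * recip n * invFact n     ≡⟨ cong (_* invFact n) (fromℕ-recip n) ⟩
  1ℚ * invFact n                          ≡⟨ ℚ.*-identityˡ (invFact n) ⟩
  invFact n                               ∎
  where open ≡-Reasoning

fromℕ-!-invFact : ∀ n → fromℕ (n !) * invFact n ≡ 1ℚ
fromℕ-!-invFact zero    = refl
fromℕ-!-invFact (suc n) = begin
  fromℕ (suc n ℕ.* n !) * invFact (suc n)          ≡⟨ cong (_* invFact (suc n)) (fromℕ-homo-* (suc n) (n !)) ⟩
  fromℕ (suc n) * fromℕ (n !) * invFact (suc n)    ≡⟨ solve 3 (λ a b c → a :* b :* c := b :* (a :* c)) refl (fromℕ (suc n)) (fromℕ (n !)) (invFact (suc n)) ⟩
  fromℕ (n !) * (fromℕ (suc n) * invFact (suc n))  ≡⟨ cong (fromℕ (n !) *_) (fromℕ-invFact-suc n) ⟩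
  fromℕ (n !) * invFact n                          ≡⟨ fromℕ-!-invFact n ⟩
  1ℚ                                               ∎
  where open ≡-Reasoning

-- The volume polynomial

vol : Vec ℚ n → ℚ
vol {n} x = invFact n * parkingSum x

-- In dimension 0 the slice is a point for every s, so s is dropped there.
infixr 5 _⊕_
_⊕_ : ℚ → Vec ℚ n → Vec ℚ n
s ⊕ []       = []
s ⊕ (x ∷ xs) = s + x ∷ xs

weight-nonNeg : {x : Vec ℚ n} → VecAll.All (0ℚ ℚ.≤_) x → ∀ l → 0ℚ ℚ.≤ weight x l
weight-nonNeg []         l             = ℚ.≤-refl
weight-nonNeg (p ∷ ps)   0             = ℚ.≤-refl
weight-nonNeg (p ∷ ps)   1             = p
weight-nonNeg (p ∷ ps)   (suc (suc l)) = weight-nonNeg ps (suc l)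

weight-mono-head : ∀ {s t} → s ℚ.≤ t → (xs : Vec ℚ n) → ∀ l → weight (s ∷ xs) l ℚ.≤ weight (t ∷ xs) l
weight-mono-head s≤t xs 0             = ℚ.≤-refl
weight-mono-head s≤t xs 1             = s≤t
weight-mono-head s≤t xs (suc (suc l)) = ℚ.≤-refl

weight-shift : ∀ s t (xs : Vec ℚ n) → ShiftsAt1 (suc n) (weight (s ∷ xs)) (weight (t ∷ xs)) (t - s)
weight-shift {n} s t xs h =
  solve 4 (λ s t a r → t :* a :+ r := s :* a :+ r :+ (t :- s) :* a) refl
    s t (h 1) (∑ n (λ l → weight xs l * h (suc l)))

parkingIndicator-nonNeg : ∀ n a → 0ℚ ℚ.≤ parkingIndicator n a
parkingIndicator-nonNeg n a = indicator-nonNeg (rearrangesBelow? (Vec.tabulate (suc ∘ toℕ)) a)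

parkingIndicator-symmetric : ∀ n → Symmetric (parkingIndicator n)
parkingIndicator-symmetric n a b a↭b =
  indicator-cong (mk⇔ (rearrangesBelow-resp-↭ u {a} {b} a↭b) (rearrangesBelow-resp-↭ u {b} {a} (↭-sym a↭b)))
    (rearrangesBelow? u a) (rearrangesBelow? u b)
  where u = Vec.tabulate (suc ∘ toℕ)

∑-collapse : ∀ s x (xs : Vec ℚ n) (h : ℕ → ℚ) →
  ∑ (suc (suc n)) (λ l → weight (s ∷ x ∷ xs) l * h (collapse l)) ≡ ∑ (suc n) (λ l → weight (s + x ∷ xs) l * h l)
∑-collapse {n} s x xs h =
  solve 4 (λ s x a r → s :* a :+ (x :* a :+ r) := (s :+ x) :* a :+ r) refl
    s x (h 1) (∑ n (λ l → weight xs l * h (suc l)))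

-- Identifying the letters 1 and 2 adds their weights s and x₂, and the later letters move down by
-- one. This is how the parameters of a slice of `Π` arise from parking functions.
wordSum-1∷ : ∀ s (xs : Vec ℚ n) →
  wordSum (suc n) (weight (s ∷ xs)) n (λ b → parkingIndicator (suc n) (1 ∷ b)) ≡ parkingSum (s ⊕ xs)
wordSum-1∷ {n} s xs = trans
  (wordSum-cong (suc n) (weight (s ∷ xs)) n
    {λ b → parkingIndicator (suc n) (1 ∷ b)} {λ b → parkingIndicator n (Vec.map collapse b)}
    (λ b → indicator-cong (parking-1∷⇔parking-collapse b)
    (rearrangesBelow? (Vec.tabulate (suc ∘ toℕ)) (1 ∷ b))
    (rearrangesBelow? (Vec.tabulate (suc ∘ toℕ)) (Vec.map collapse b))))
  (push s xs)
  where
  push : ∀ {n} s (xs : Vec ℚ n) →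
    wordSum (suc n) (weight (s ∷ xs)) n (λ b → parkingIndicator n (Vec.map collapse b)) ≡ parkingSum (s ⊕ xs)
  push         s []       = refl
  push {suc n} s (x ∷ xs) =
    wordSum-pushforward (suc (suc n)) (suc n) {weight (s ∷ x ∷ xs)} {weight (s + x ∷ xs)} {collapse}
      (∑-collapse s x xs) (suc n) (parkingIndicator (suc n))

vol-increment : ∀ n a b d → invFact (suc n) * (a + fromℕ (suc n) * (d * b)) ≡ invFact (suc n) * a + d * (invFact n * b)
vol-increment n a b d = begin
  invFact (suc n) * (a + fromℕ (suc n) * (d * b))
    ≡⟨ solve 5 (λ v a c d b → v :* (a :+ c :* (d :* b)) := v :* a :+ d :* ((c :* v) :* b)) refl
         (invFact (suc n)) a (fromℕ (suc n)) d b ⟩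
  invFact (suc n) * a + d * (fromℕ (suc n) * invFact (suc n) * b)
    ≡⟨ cong (λ v → invFact (suc n) * a + d * (v * b)) (fromℕ-invFact-suc n) ⟩
  invFact (suc n) * a + d * (invFact n * b) ∎
  where open ≡-Reasoning

module _ {s t : ℚ} (0≤s : 0ℚ ℚ.≤ s) (s≤t : s ℚ.≤ t) {xs : Vec ℚ n} (0≤xs : VecAll.All (0ℚ ℚ.≤_) xs) where

  -- Upper half of the difference form of ∂V/∂x₁ = V(x₁ + x₂, x₃, ...), with the derivative taken at
  -- the right end; `vol-≥` takes it at the left end.
  vol-≤ : vol (t ∷ xs) ℚ.≤ vol (s ∷ xs) + (t - s) * vol (t ⊕ xs)
  vol-≤ = begin
    vol (t ∷ xs)
      ≤⟨ *-monoʳ (invFact-nonNeg (suc n)) (wordSum-shift-≤ {suc n} {weight (s ∷ xs)} {weight (t ∷ xs)}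
           (weight-nonNeg (0≤s ∷ 0≤xs)) (weight-mono-head s≤t xs) (≤⇒0≤- s≤t) (weight-shift s t xs) n {parkingIndicator (suc n)}
           (parkingIndicator-symmetric (suc n)) (parkingIndicator-nonNeg (suc n))) ⟩
    invFact (suc n) * (parkingSum (s ∷ xs) + fromℕ (suc n) * ((t - s) *
      wordSum (suc n) (weight (t ∷ xs)) n (λ b → parkingIndicator (suc n) (1 ∷ b))))
      ≡⟨ cong (λ p → invFact (suc n) * (parkingSum (s ∷ xs) + fromℕ (suc n) * ((t - s) * p))) (wordSum-1∷ t xs) ⟩
    invFact (suc n) * (parkingSum (s ∷ xs) + fromℕ (suc n) * ((t - s) * parkingSum (t ⊕ xs)))
      ≡⟨ vol-increment n (parkingSum (s ∷ xs)) (parkingSum (t ⊕ xs)) (t - s) ⟩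
    vol (s ∷ xs) + (t - s) * vol (t ⊕ xs) ∎
    where open ℚ.≤-Reasoning

  vol-≥ : vol (s ∷ xs) + (t - s) * vol (s ⊕ xs) ℚ.≤ vol (t ∷ xs)
  vol-≥ = begin
    vol (s ∷ xs) + (t - s) * vol (s ⊕ xs)
      ≡⟨ vol-increment n (parkingSum (s ∷ xs)) (parkingSum (s ⊕ xs)) (t - s) ⟨
    invFact (suc n) * (parkingSum (s ∷ xs) + fromℕ (suc n) * ((t - s) * parkingSum (s ⊕ xs)))
      ≡⟨ cong (λ p → invFact (suc n) * (parkingSum (s ∷ xs) + fromℕ (suc n) * ((t - s) * p))) (wordSum-1∷ s xs) ⟨
    invFact (suc n) * (parkingSum (s ∷ xs) + fromℕ (suc n) * ((t - s) *
      wordSum (suc n) (weight (s ∷ xs)) n (λ b → parkingIndicator (suc n) (1 ∷ b))))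
      ≤⟨ *-monoʳ (invFact-nonNeg (suc n)) (wordSum-shift-≥ {suc n} {weight (s ∷ xs)} {weight (t ∷ xs)}
           (weight-nonNeg (0≤s ∷ 0≤xs)) (weight-mono-head s≤t xs) (≤⇒0≤- s≤t) (weight-shift s t xs) n {parkingIndicator (suc n)}
           (parkingIndicator-symmetric (suc n)) (parkingIndicator-nonNeg (suc n))) ⟩
    vol (t ∷ xs) ∎
    where open ℚ.≤-Reasoning

indicator-split : ∀ {P : Set} (p? : Dec P) → P ⊎ indicator p? ≡ 0ℚ
indicator-split (yes p) = inj₁ p
indicator-split (no _)  = inj₂ refl

-- Every parking function contains the letter 1, whose weight is 0 here. This fixes the constant of
-- integration.
vol-0 : (xs : Vec ℚ n) → vol (0ℚ ∷ xs) ≡ 0ℚ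
vol-0 {n} xs = trans
  (cong (invFact (suc n) *_) (wordSum-zero (suc n) {weight (0ℚ ∷ xs)} (suc n) {parkingIndicator (suc n)} vanish))
  (ℚ.*-zeroʳ (invFact (suc n)))
  where
  -- The letter 0 has weight 0 by default, the letter 1 because the first parameter is 0.
  weight≤1 : ∀ {l} → l ≤ 1 → weight (0ℚ ∷ xs) l ≡ 0ℚ
  weight≤1 {0} _ = refl
  weight≤1 {1} _ = refl
  weight≤1 {suc (suc _)} (s≤s ())

  vanish : ∀ a → ListAny.Any (λ l → weight (0ℚ ∷ xs) l ≡ 0ℚ) (toList a) ⊎ parkingIndicator (suc n) a ≡ 0ℚ
  vanish a = Sum.map₁ (λ park → ListAny.map weight≤1 (parking⇒∃≤1 {a = a} park))
    (indicator-split (rearrangesBelow? (Vec.tabulate (suc ∘ toℕ)) a))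

vol-[] : vol [] ≡ 1ℚ
vol-[] = trans (ℚ.*-identityˡ (parkingIndicator 0 []))
  (cong (if_then 1ℚ else 0ℚ) (dec-true (rearrangesBelow? [] []) parking-[]))

-- The volume polynomial as a list of coefficients and exponents

Term : ℕ → Set
Term n = ℚ × Vec ℕ n

monomial : Vec ℚ n → Vec ℕ n → ℚ
monomial x e = Vec.foldr′ _*_ 1ℚ (Vec.zipWith _^_ x e)

evalTerm : Vec ℚ n → Term n → ℚ
evalTerm x (c , e) = c * monomial x e

_·_ : Term n → Term n → Term n
(c , e) · (c′ , e′) = c * c′ , Vec.zipWith ℕ._+_ e e′

evalTerm-· : (x : Vec ℚ n) (p q : Term n) → evalTerm x (p · q) ≡ evalTerm x p * evalTerm x q
evalTerm-· x (c , e) (c′ , e′) = trans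
  (cong (c * c′ *_) (monomial-+ x e e′))
  (solve 4 (λ c c′ m m′ → (c :* c′) :* (m :* m′) := (c :* m) :* (c′ :* m′)) refl c c′ _ _)
  where
  monomial-+ : ∀ {n} (x : Vec ℚ n) (e e′ : Vec ℕ n) →
    monomial x (Vec.zipWith ℕ._+_ e e′) ≡ monomial x e * monomial x e′
  monomial-+ []       []      []        = refl
  monomial-+ (x ∷ xs) (a ∷ e) (b ∷ e′) = trans
    (cong₂ _*_ (Exp.^-homo-* x a b) (monomial-+ xs e e′))
    (solve 4 (λ a b m m′ → (a :* b) :* (m :* m′) := (a :* m) :* (b :* m′)) refl (x ^ a) (x ^ b) _ _)

-- Letters outside 1, …, n get coefficient 0, to agree with _‼_.
letterTerm : ∀ n → ℕ → Term n
letterTerm zero    _             = 0ℚ , []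
letterTerm (suc n) 0             = 0ℚ , Vec.replicate (suc n) 0
letterTerm (suc n) 1             = 1ℚ , 1 ∷ Vec.replicate n 0
letterTerm (suc n) (suc (suc l)) = let c , e = letterTerm n (suc l) in c , 0 ∷ e

monomial-0 : (x : Vec ℚ n) → monomial x (Vec.replicate n 0) ≡ 1ℚ
monomial-0 []       = refl
monomial-0 (x ∷ xs) = trans (ℚ.*-identityˡ _) (monomial-0 xs)

evalTerm-letter : (x : Vec ℚ n) (l : ℕ) → evalTerm x (letterTerm n l) ≡ weight x l
evalTerm-letter []       l             = refl
evalTerm-letter {suc n} (x ∷ xs) 0     = ℚ.*-zeroˡ (monomial (x ∷ xs) (Vec.replicate (suc n) 0))
evalTerm-letter (x ∷ xs) 1             = trans
  (cong (λ m → 1ℚ * (x * 1ℚ * m)) (monomial-0 xs))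
  (solve 1 (λ x → con 1ℚ :* (x :* con 1ℚ :* con 1ℚ) := x) refl x)
evalTerm-letter {suc n} (x ∷ xs) (suc (suc l)) =
  trans (cong (proj₁ (letterTerm n (suc l)) *_) (ℚ.*-identityˡ _)) (evalTerm-letter xs (suc l))

wordTerm : ∀ n → Vec ℕ m → Term n
wordTerm n []      = 1ℚ , Vec.replicate n 0
wordTerm n (l ∷ a) = letterTerm n l · wordTerm n a

evalTerm-word : (x : Vec ℚ n) (a : Vec ℕ m) → evalTerm x (wordTerm n a) ≡ wordWeight (weight x) a
evalTerm-word     x []      = trans (ℚ.*-identityˡ _) (monomial-0 x)
evalTerm-word {n} x (l ∷ a) = trans (evalTerm-· x (letterTerm n l) (wordTerm n a))
  (cong₂ _*_ (evalTerm-letter x l) (evalTerm-word x a))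

-- One term for each parking function, like terms not collected; 1/n! enters as a constant term
-- multiplied in.
volumePolynomial : ∀ n → Polynomial n
volumePolynomial n = List.map (λ a → (invFact n , Vec.replicate n 0) · wordTerm n a) (park n)

eval-volumePolynomial : (x : Vec ℚ n) → eval (volumePolynomial n) x ≡ vol x
eval-volumePolynomial {n} x = begin
  eval (volumePolynomial n) x
    ≡⟨ cong (List.foldr _+_ 0ℚ) (map-cong {f = _} {g = evalTerm x} (λ _ → refl) (volumePolynomial n)) ⟩
  sumOver (evalTerm x) (volumePolynomial n)
    ≡⟨ sumOver-map (evalTerm x) _ (park n) ⟩
  sumOver (λ a → evalTerm x ((invFact n , Vec.replicate n 0) · wordTerm n a)) (park n)
    ≡⟨ sumOver-cong term (park n) ⟩
  sumOver (λ a → invFact n * wordWeight (weight x) a) (park n)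
    ≡⟨ sumOver-* (invFact n) (wordWeight (weight x)) (park n) ⟩
  invFact n * sumOver (wordWeight (weight x)) (park n)
    ≡⟨ cong (invFact n *_) (sumOver-park x) ⟩
  vol x ∎
  where
  open ≡-Reasoning

  term : ∀ a → evalTerm x ((invFact n , Vec.replicate n 0) · wordTerm n a) ≡ invFact n * wordWeight (weight x) a
  term a = trans (evalTerm-· x (invFact n , Vec.replicate n 0) (wordTerm n a))
    (cong₂ _*_ (trans (cong (invFact n *_) (monomial-0 x)) (ℚ.*-identityʳ (invFact n))) (evalTerm-word x a))

-- Volumes by slicing

-- The denominator is at least 1, so the numerator already bounds the fraction; the successor is
-- there to cancel the denominator of `recip`.
≤-fromℕ : ∀ q → q ℚ.≤ fromℕ (suc ℤ.∣ ℚ.↥ q ∣)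
≤-fromℕ q@(ℚ.mkℚ p d _) = ℚ.toℚᵘ-cancel-≤ (begin
  mkℚᵘ p d                            ≤⟨ *≤* p≤ ⟩
  mkℚᵘ (ℤ.+ suc ℤ.∣ p ∣) 0           ≃⟨ ℚ.toℚᵘ-fromℚᵘ (mkℚᵘ (ℤ.+ suc ℤ.∣ p ∣) 0) ⟨
  ℚ.toℚᵘ (fromℕ (suc ℤ.∣ p ∣))       ∎)
  where
  open ℚᵘ.≤-Reasoning

  ≤∣∣ : ∀ i → i ℤ.≤ ℤ.+ ℤ.∣ i ∣
  ≤∣∣ (ℤ.+ n)      = ℤ.≤-refl
  ≤∣∣ (ℤ.-[1+ n ]) = ℤ.-≤+

  p≤ : p ℤ.* ℤ.+ 1 ℤ.≤ ℤ.+ suc ℤ.∣ p ∣ ℤ.* ℤ.+ suc d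
  p≤ = ℤ.≤-trans (ℤ.≤-reflexive (ℤ.*-identityʳ p)) (ℤ.≤-trans (≤∣∣ p)
         (ℤ.+≤+ (ℕ.≤-trans (ℕ.n≤1+n _) (ℕ.m≤m*n (suc ℤ.∣ p ∣) (suc d)))))

archimedean : ∀ c {ε} → 0ℚ ℚ.< ε → ∃ λ N → recip N * c ℚ.≤ ε
archimedean c {ε} 0<ε = N , (begin
  recip N * c                        ≡⟨ cong (recip N *_) (ℚ.*-identityʳ c) ⟨
  recip N * (c * 1ℚ)                 ≡⟨ cong (λ u → recip N * (c * u)) (ℚ.*-inverseˡ ε) ⟨
  recip N * (c * (ℚ.1/ ε * ε))       ≡⟨ solve 4 (λ r c i e → r :* (c :* (i :* e)) := (r :* e) :* (c :* i)) refl (recip N) c (ℚ.1/ ε) ε ⟩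
  recip N * ε * q                    ≤⟨ *-monoʳ (*-nonNeg (ℚ.<⇒≤ (recip-pos N)) (ℚ.<⇒≤ 0<ε)) (≤-fromℕ q) ⟩
  recip N * ε * fromℕ (suc N)        ≡⟨ solve 3 (λ r e f → r :* e :* f := f :* r :* e) refl (recip N) ε (fromℕ (suc N)) ⟩
  fromℕ (suc N) * recip N * ε        ≡⟨ cong (_* ε) (fromℕ-recip N) ⟩
  1ℚ * ε                             ≡⟨ ℚ.*-identityˡ ε ⟩
  ε                                  ∎)
  where
  open ℚ.≤-Reasoning
  instance
    _ = ℚ.positive 0<ε
    _ = ℚ.pos⇒nonZero ε
  -- The claim amounts to c/ε ≤ N + 1.
  q = c * ℚ.1/ ε
  N = ℤ.∣ ℚ.↥ q ∣

-- The points k · d, by recursion so that neighbours differ by d definitionally, as the telescoping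
-- identities expect.
grid : ℚ → ℕ → ℚ
grid d zero    = 0ℚ
grid d (suc k) = grid d k + d

grid≡fromℕ : ∀ d k → grid d k ≡ fromℕ k * d
grid≡fromℕ d zero    = sym (ℚ.*-zeroˡ d)
grid≡fromℕ d (suc k) = begin
  grid d k + d          ≡⟨ cong (_+ d) (grid≡fromℕ d k) ⟩
  fromℕ k * d + d       ≡⟨ solve 2 (λ k d → k :* d :+ d := (con 1ℚ :+ k) :* d) refl (fromℕ k) d ⟩
  (1ℚ + fromℕ k) * d    ≡⟨ cong (_* d) (fromℕ-suc k) ⟨
  fromℕ (suc k) * d     ∎
  where open ≡-Reasoning

grid-nonNeg : ∀ {d} → 0ℚ ℚ.≤ d → ∀ k → 0ℚ ℚ.≤ grid d k
grid-nonNeg 0≤d zero    = ℚ.≤-refl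
grid-nonNeg 0≤d (suc k) = +-nonNeg (grid-nonNeg 0≤d k) 0≤d

grid-≤-suc : ∀ {d} → 0ℚ ℚ.≤ d → ∀ k → grid d k ℚ.≤ grid d (suc k)
grid-≤-suc {d} 0≤d k =
  ≤-by 0≤d (solve 2 (λ d s → d :- con 0ℚ := s :+ d :- s) refl d (grid d k))

grid-recip : ∀ x N → grid (x * recip N) (suc N) ≡ x
grid-recip x N = begin
  grid (x * recip N) (suc N)       ≡⟨ grid≡fromℕ (x * recip N) (suc N) ⟩
  fromℕ (suc N) * (x * recip N)    ≡⟨ solve 3 (λ f x r → f :* (x :* r) := x :* (f :* r)) refl (fromℕ (suc N)) x (recip N) ⟩
  x * (fromℕ (suc N) * recip N)    ≡⟨ cong (x *_) (fromℕ-recip N) ⟩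
  x * 1ℚ                           ≡⟨ ℚ.*-identityʳ x ⟩
  x                                ∎
  where open ≡-Reasoning

-- Slices of Π and slabs over them

prefixSums-⊕ : ∀ s (xs : Vec ℚ n) → prefixSums _+_ (s ⊕ xs) ≡ Vec.map (s +_) (prefixSums _+_ xs)
prefixSums-⊕ s []       = refl
prefixSums-⊕ s (x ∷ xs) = cong (s + x ∷_) (map-+ (prefixSums _+_ xs))
  where
  map-+ : ∀ {m} (us : Vec ℚ m) → Vec.map (s + x +_) us ≡ Vec.map (s +_) (Vec.map (x +_) us)
  map-+ []       = refl
  map-+ (u ∷ us) = cong₂ _∷_ (ℚ.+-assoc s x u) (map-+ us)

⊕-nonNeg : ∀ {s} {xs : Vec ℚ n} → 0ℚ ℚ.≤ s → VecAll.All (0ℚ ℚ.≤_) xs → VecAll.All (0ℚ ℚ.≤_) (s ⊕ xs)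
⊕-nonNeg 0≤s []         = []
⊕-nonNeg 0≤s (0≤x ∷ ps) = +-nonNeg 0≤s 0≤x ∷ ps

-- The slice at y has parameters (x - y) ⊕ xs and grows as y decreases. For x - t ≤ y ≤ x - s it
-- lies between the slices belonging to s and t; this is the inner inclusion and `Π-∷⁻` the outer
-- one.
Π-∷⁺ : ∀ {s x y} {xs ys : Vec ℚ n} → 0ℚ ℚ.≤ y → y ℚ.≤ x → y ℚ.≤ x - s → Π (s ⊕ xs) ys → Π (x ∷ xs) (y ∷ ys)
Π-∷⁺ {s = s} {x} {y} {xs} {ys} 0≤y y≤x y≤x-s (pos , below) =
  0≤y ∷ pos , y≤x ∷ shift (prefixSums _+_ ys) (prefixSums _+_ xs) (subst (Pointwise ℚ._≤_ _) (prefixSums-⊕ s xs) below)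
  where
  shift : ∀ {m} (ps us : Vec ℚ m) → Pointwise ℚ._≤_ ps (Vec.map (s +_) us) →
          Pointwise ℚ._≤_ (Vec.map (y +_) ps) (Vec.map (x +_) us)
  shift []       []       []         = []
  shift (p ∷ ps) (u ∷ us) (le ∷ les) =
    ≤-by (ℚ.+-mono-≤ y≤x-s le)
      (solve 5 (λ x s u y p → (x :- s) :+ (s :+ u) :- (y :+ p) := x :+ u :- (y :+ p)) refl x s u y p)
    ∷ shift ps us les

Π-∷⁻ : ∀ {t x y} {xs ys : Vec ℚ n} → x - t ℚ.≤ y → Π (x ∷ xs) (y ∷ ys) → Π (t ⊕ xs) ys
Π-∷⁻ {t = t} {x} {y} {xs} {ys} x-t≤y (_ ∷ pos , _ ∷ below) =
  pos , subst (Pointwise ℚ._≤_ _) (sym (prefixSums-⊕ t xs)) (shift (prefixSums _+_ ys) (prefixSums _+_ xs) below)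
  where
  shift : ∀ {m} (ps us : Vec ℚ m) → Pointwise ℚ._≤_ (Vec.map (y +_) ps) (Vec.map (x +_) us) →
          Pointwise ℚ._≤_ ps (Vec.map (t +_) us)
  shift []       []       []         = []
  shift (p ∷ ps) (u ∷ us) (le ∷ les) =
    ≤-by (ℚ.+-mono-≤ x-t≤y le)
      (solve 5 (λ x t u y p → y :+ (x :+ u) :- (x :- t :+ (y :+ p)) := t :+ u :- p) refl x t u y p)
    ∷ shift ps us les

slabBox : ∀ {a b} → a ℚ.≤ b → Box n → Box (suc n)
slabBox {a = a} {b} a≤b B = record { lower = a ∷ lower B ; upper = b ∷ upper B ; lower≤upper = a≤b ∷ lower≤upper B }

totalVolume-slab : ∀ {a b} (a≤b : a ℚ.≤ b) (Bs : List (Box n)) →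
  totalVolume (List.map (slabBox a≤b) Bs) ≡ (b - a) * totalVolume Bs
totalVolume-slab {a = a} {b} a≤b Bs =
  trans (sumOver-map boxVolume (slabBox a≤b) Bs) (sumOver-* (b - a) boxVolume Bs)

-- The lower sum gains d · g(s) over a step, while `G-≤` bounds the growth of G only by d · g(s +
-- d). The gap d · (g(s + d) - g(s)) is exactly what the correction d · (g(s) - g(0)) gains over the
-- step.
inner-telescope : ∀ Gs Gt gs gt g₀ d s e →
  Gs + (s + d - s) * gt - Gt ≡
  Gs - d * (gs - g₀) - s * e + (s + d - s) * (gs - e) - (Gt - d * (gt - g₀) - (s + d) * e)
inner-telescope = solve 8 (λ Gs Gt gs gt g₀ d s e →
  Gs :+ (s :+ d :- s) :* gt :- Gt :=
  Gs :- d :* (gs :- g₀) :- s :* e :+ (s :+ d :- s) :* (gs :- e) :- (Gt :- d :* (gt :- g₀) :- (s :+ d) :* e)) refl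

outer-telescope : ∀ Gs Gt gs gt g₀ d s e →
  Gt - (Gs + (s + d - s) * gs) ≡
  Gt + d * (gt - g₀) + (s + d) * e - (Gs + d * (gs - g₀) + s * e + (s + d - s) * (gt + e))
outer-telescope = solve 8 (λ Gs Gt gs gt g₀ d s e →
  Gt :- (Gs :+ (s :+ d :- s) :* gs) :=
  Gt :+ d :* (gt :- g₀) :+ (s :+ d) :* e :- (Gs :+ d :* (gs :- g₀) :+ s :* e :+ (s :+ d :- s) :* (gt :+ e))) refl

slab-identity : ∀ b c x s t → b + (t - s) * c ≡ (x - s - (x - t)) * c + b
slab-identity = solve 5 (λ b c x s t → b :+ (t :- s) :* c := (x :- s :- (x :- t)) :* c :+ b) refl

lower-identity : ∀ v a b e → e - (a + b) ≡ v - a - b - (v - e)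
lower-identity = solve 4 (λ v a b e → e :- (a :+ b) := v :- a :- b :- (v :- e)) refl

upper-identity : ∀ v a b e → e - (a + b) ≡ v + e - (v + a + b)
upper-identity = solve 4 (λ v a b e → e :- (a :+ b) := v :+ e :- (v :+ a :+ b)) refl

-- G-≤ and G-≥ say that G is the integral of g.  On a grid of width d the Riemann
-- sums of g differ from G by at most d * (g x - g 0), and approximating every
-- slice up to ε adds at most x * ε.
module Slabs {x : ℚ} {xs : Vec ℚ n} (0≤x : 0ℚ ℚ.≤ x) (g G : ℚ → ℚ)
  (G-0 : G 0ℚ ≡ 0ℚ)
  (G-≤ : ∀ {s t} → 0ℚ ℚ.≤ s → s ℚ.≤ t → G t ℚ.≤ G s + (t - s) * g t)
  (G-≥ : ∀ {s t} → 0ℚ ℚ.≤ s → s ℚ.≤ t → G s + (t - s) * g s ℚ.≤ G t)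
  (slice : ∀ t → 0ℚ ℚ.≤ t → HasVolume (Π (t ⊕ xs)) (g t)) where

  x-mono : ∀ {s t} → s ℚ.≤ t → x - t ℚ.≤ x - s
  x-mono {s} {t} s≤t = ≤-by s≤t (solve 3 (λ x s t → t :- s := x :- s :- (x :- t)) refl x s t)

  -- As s grows, slabs are stacked downwards from y₁ = x. The bound on the first lower coordinate
  -- keeps the boxes already placed apart from the next slab.
  InnerSlabs : ℚ → ℚ → Set
  InnerSlabs s v = ∃ λ (Bs : List (Box (suc n))) →
    AllPairs NonOverlapping Bs ×
    All (λ B → x - s ℚ.≤ lookup (lower B) zero × (∀ y → y ∈ᵇ B → Π (x ∷ xs) y)) Bs ×
    v ℚ.≤ totalVolume Bs

  inner-weaken : ∀ {s u v} → u ℚ.≤ v → InnerSlabs s v → InnerSlabs s u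
  inner-weaken u≤v (Bs , disjoint , inside , v≤) = Bs , disjoint , inside , ℚ.≤-trans u≤v v≤

  inner-step : ∀ {s t ε v} → 0ℚ ℚ.≤ s → s ℚ.≤ t → t ℚ.≤ x → 0ℚ ℚ.< ε →
               InnerSlabs s v → InnerSlabs t (v + (t - s) * (g s - ε))
  inner-step {s} {t} {ε} {v} 0≤s s≤t t≤x 0<ε (Bs , disjoint , inside , v≤) =
    new List.++ Bs ,
    -- Two new boxes are separated by a coordinate of the slice, a new box and an old one by the
    -- first coordinate at x - s.
    AllPairs.++⁺ (AllPairs.map⁺ (AllPairs.map (λ (i , sep) → suc i , sep) Cs-disjoint)) disjoint
      (ListAll.map⁺ (ListAll.universal (λ C → ListAll.map (λ (x-s≤ , _) → zero , inj₁ x-s≤) inside) Cs)) ,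
    ListAll.++⁺
      (ListAll.map⁺ (ListAll.map (λ {C} C⊆ → ℚ.≤-refl {x - t} , slab⊆ {C} C⊆) Cs-inside))
      (ListAll.map (λ (x-s≤ , B⊆) → ℚ.≤-trans (x-mono s≤t) x-s≤ , B⊆) inside) ,
    (begin
      v + (t - s) * (g s - ε)                         ≤⟨ ℚ.+-mono-≤ v≤ (*-monoʳ (≤⇒0≤- s≤t) Cs-volume) ⟩
      totalVolume Bs + (t - s) * totalVolume Cs       ≡⟨ slab-identity (totalVolume Bs) (totalVolume Cs) x s t ⟩
      (x - s - (x - t)) * totalVolume Cs + totalVolume Bs ≡⟨ cong (_+ totalVolume Bs) (totalVolume-slab (x-mono s≤t) Cs) ⟨
      totalVolume new + totalVolume Bs                ≡⟨ sumOver-++ boxVolume new Bs ⟨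
      totalVolume (new List.++ Bs)                    ∎)
    where
    open ℚ.≤-Reasoning
    -- The smallest slice of the slab, at its top y₁ = x - s, fits inside all the others.
    approx = HasVolume.inner (slice s 0≤s) ε 0<ε
    Cs = proj₁ approx
    Cs-disjoint = proj₁ (proj₂ approx)
    Cs-inside = proj₁ (proj₂ (proj₂ approx))
    Cs-volume = proj₂ (proj₂ (proj₂ approx))
    new = List.map (slabBox (x-mono s≤t)) Cs

    slab⊆ : ∀ {C} → (∀ y → y ∈ᵇ C → Π (s ⊕ xs) y) → ∀ y → y ∈ᵇ slabBox (x-mono s≤t) C → Π (x ∷ xs) y
    slab⊆ C⊆ (y ∷ ys) (x-t≤y ∷ lo , y≤x-s ∷ hi) =
      Π-∷⁺ {s = s}
        (ℚ.≤-trans (≤⇒0≤- t≤x) x-t≤y)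
        (ℚ.≤-trans y≤x-s (≤-by 0≤s (solve 2 (λ x s → s :- con 0ℚ := x :- (x :- s)) refl x s)))
        y≤x-s (C⊆ ys (lo , hi))

  inner-grid : ∀ {d ε} → 0ℚ ℚ.≤ d → 0ℚ ℚ.< ε → ∀ k → grid d k ℚ.≤ x →
               InnerSlabs (grid d k) (G (grid d k) - d * (g (grid d k) - g 0ℚ) - grid d k * ε)
  inner-grid {d} {ε} 0≤d 0<ε zero _ =
    [] , [] , [] ,
    ℚ.≤-reflexive (trans (cong (λ v → v - d * (g 0ℚ - g 0ℚ) - 0ℚ * ε) G-0)
      (solve 3 (λ d c e → con 0ℚ :- d :* (c :- c) :- con 0ℚ :* e := con 0ℚ) refl d (g 0ℚ) ε))
  inner-grid {d} {ε} 0≤d 0<ε (suc k) t≤x = inner-weaken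
    (≤-by (G-≤ (grid-nonNeg 0≤d k) (grid-≤-suc 0≤d k))
      (inner-telescope (G s) (G (s + d)) (g s) (g (s + d)) (g 0ℚ) d s ε))
    (inner-step (grid-nonNeg 0≤d k) (grid-≤-suc 0≤d k) t≤x 0<ε
      (inner-grid 0≤d 0<ε k (ℚ.≤-trans (grid-≤-suc 0≤d k) t≤x)))
    where s = grid d k

  OuterSlabs : ℚ → ℚ → Set
  OuterSlabs s v = ∃ λ (Bs : List (Box (suc n))) →
    (∀ y ys → Π (x ∷ xs) (y ∷ ys) → x - s ℚ.≤ y → ListAny.Any ((y ∷ ys) ∈ᵇ_) Bs) ×
    totalVolume Bs ℚ.≤ v

  slab-cover : ∀ {t b} (x-t≤b : x - t ℚ.≤ b) {Cs} → (∀ ys → Π (t ⊕ xs) ys → ListAny.Any (ys ∈ᵇ_) Cs) →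
    ∀ y ys → Π (x ∷ xs) (y ∷ ys) → x - t ℚ.≤ y → y ℚ.≤ b →
    ListAny.Any ((y ∷ ys) ∈ᵇ_) (List.map (slabBox x-t≤b) Cs)
  slab-cover {t} x-t≤b cover y ys y∷ys∈ x-t≤y y≤b =
    ListAny.map⁺ (ListAny.map (λ (lo , hi) → x-t≤y ∷ lo , y≤b ∷ hi) (cover ys (Π-∷⁻ {t = t} x-t≤y y∷ys∈)))

  outer-weaken : ∀ {s u v} → u ℚ.≤ v → OuterSlabs s u → OuterSlabs s v
  outer-weaken u≤v (Bs , cover , ≤u) = Bs , cover , ℚ.≤-trans ≤u u≤v

  outer-step : ∀ {s t ε v} → 0ℚ ℚ.≤ s → s ℚ.≤ t → 0ℚ ℚ.< ε →
               OuterSlabs s v → OuterSlabs t (v + (t - s) * (g t + ε))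
  outer-step {s} {t} {ε} {v} 0≤s s≤t 0<ε (Bs , cover , ≤v) =
    new List.++ Bs , cover′ ,
    (begin
      totalVolume (new List.++ Bs)                    ≡⟨ sumOver-++ boxVolume new Bs ⟩
      totalVolume new + totalVolume Bs                ≡⟨ cong (_+ totalVolume Bs) (totalVolume-slab (x-mono s≤t) Cs) ⟩
      (x - s - (x - t)) * totalVolume Cs + totalVolume Bs ≡⟨ slab-identity (totalVolume Bs) (totalVolume Cs) x s t ⟨
      totalVolume Bs + (t - s) * totalVolume Cs       ≤⟨ ℚ.+-mono-≤ ≤v (*-monoʳ (≤⇒0≤- s≤t) Cs-volume) ⟩
      v + (t - s) * (g t + ε)                         ∎)
    where
    open ℚ.≤-Reasoning
    -- The largest slice of the slab, at its bottom y₁ = x - t, contains all the others.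
    approx = HasVolume.outer (slice t (ℚ.≤-trans 0≤s s≤t)) ε 0<ε
    Cs = proj₁ approx
    Cs-cover = proj₁ (proj₂ approx)
    Cs-volume = proj₂ (proj₂ approx)
    new = List.map (slabBox (x-mono s≤t)) Cs

    cover′ : ∀ y ys → Π (x ∷ xs) (y ∷ ys) → x - t ℚ.≤ y → ListAny.Any ((y ∷ ys) ∈ᵇ_) (new List.++ Bs)
    cover′ y ys y∷ys∈ x-t≤y = Sum.[
      (λ y≤x-s → ListAny.++⁺ˡ {P = (y ∷ ys) ∈ᵇ_} {new} {Bs} (slab-cover {t} {x - s} (x-mono s≤t) {Cs} Cs-cover y ys y∷ys∈ x-t≤y y≤x-s)) ,
      (λ x-s≤y → ListAny.++⁺ʳ {P = (y ∷ ys) ∈ᵇ_} new {Bs} (cover y ys y∷ys∈ x-s≤y)) ]′ (ℚ.≤-total y (x - s))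

  outer-grid : ∀ {d ε} → 0ℚ ℚ.≤ d → 0ℚ ℚ.< ε → ∀ k →
               OuterSlabs (grid d k) (G (grid d k) + d * (g (grid d k) - g 0ℚ) + grid d k * ε)
  outer-grid {d} {ε} 0≤d 0<ε zero =
    -- The face y₁ = x has volume 0 but must still be covered; boxes of width 0 do this.
    List.map (slabBox x-0≤x) Cs ,
    (λ { y ys y∷ys∈@(_ , y≤x ∷ _) x-0≤y → slab-cover {0ℚ} x-0≤x (proj₁ (proj₂ approx)) y ys y∷ys∈ x-0≤y y≤x }) ,
    ℚ.≤-reflexive (trans (totalVolume-slab x-0≤x Cs) (trans
      (solve 5 (λ x c d g e → (x :- (x :- con 0ℚ)) :* c := con 0ℚ :+ d :* (g :- g) :+ con 0ℚ :* e) refl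
        x (totalVolume Cs) d (g 0ℚ) ε)
      (cong (λ v → v + d * (g 0ℚ - g 0ℚ) + 0ℚ * ε) (sym G-0))))
    where
    approx = HasVolume.outer (slice 0ℚ ℚ.≤-refl) ε 0<ε
    Cs = proj₁ approx

    x-0≤x : x - 0ℚ ℚ.≤ x
    x-0≤x = ℚ.≤-reflexive (ℚ.+-identityʳ x)
  outer-grid {d} {ε} 0≤d 0<ε (suc k) = outer-weaken
    (≤-by (G-≥ (grid-nonNeg 0≤d k) (grid-≤-suc 0≤d k))
      (outer-telescope (G s) (G (s + d)) (g s) (g (s + d)) (g 0ℚ) d s ε))
    (outer-step (grid-nonNeg 0≤d k) (grid-≤-suc 0≤d k) 0<ε (outer-grid 0≤d 0<ε k))
    where s = grid d k

  width-nonNeg : ∀ N → 0ℚ ℚ.≤ x * recip N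
  width-nonNeg N = *-nonNeg 0≤x (ℚ.<⇒≤ (recip-pos N))

  -- N + 1 steps of width x/(N+1) end exactly at x. The slices are approximated to within 1/(N+1),
  -- so both errors shrink with N.
  inner-total : ∀ N → InnerSlabs x (G x - x * recip N * (g x - g 0ℚ) - x * recip N)
  inner-total N =
    subst (λ t → InnerSlabs t (G t - x * recip N * (g t - g 0ℚ) - t * recip N)) (grid-recip x N)
      (inner-grid (width-nonNeg N) (recip-pos N) (suc N) (ℚ.≤-reflexive (grid-recip x N)))

  outer-total : ∀ N → OuterSlabs x (G x + x * recip N * (g x - g 0ℚ) + x * recip N)
  outer-total N =
    subst (λ t → OuterSlabs t (G t + x * recip N * (g t - g 0ℚ) + t * recip N)) (grid-recip x N)
      (outer-grid (width-nonNeg N) (recip-pos N) (suc N))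

  error-identity : ∀ x r c → r * (x * (c + 1ℚ)) ≡ x * r * c + x * r
  error-identity = solve 3 (λ x r c → r :* (x :* (c :+ con 1ℚ)) := x :* r :* c :+ x :* r) refl

  hasVolume : HasVolume (Π (x ∷ xs)) (G x)
  hasVolume = record { inner = inner ; outer = outer }
    where
    module _ (ε : ℚ) (0<ε : 0ℚ ℚ.< ε) where
      -- The summand 1 accounts for the errors in the slices, the rest for the Riemann sum.
      N = proj₁ (archimedean (x * (g x - g 0ℚ + 1ℚ)) 0<ε)

      error≤ε : x * recip N * (g x - g 0ℚ) + x * recip N ℚ.≤ ε
      error≤ε = subst (λ e → e ℚ.≤ ε) (error-identity x (recip N) (g x - g 0ℚ))
        (proj₂ (archimedean (x * (g x - g 0ℚ + 1ℚ)) 0<ε))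

      inner : ∃ λ Bs → AllPairs NonOverlapping Bs × All (λ B → ∀ y → y ∈ᵇ B → Π (x ∷ xs) y) Bs ×
                       G x - ε ℚ.≤ totalVolume Bs
      inner =
        let Bs , disjoint , inside , ≤total = inner-weaken (≤-by error≤ε (lower-identity (G x) _ _ ε)) (inner-total N)
        in Bs , disjoint , ListAll.map proj₂ inside , ≤total

      outer : ∃ λ Bs → (∀ y → Π (x ∷ xs) y → ListAny.Any (y ∈ᵇ_) Bs) × totalVolume Bs ℚ.≤ G x + ε
      outer =
        let Bs , cover , total≤ = outer-weaken (≤-by error≤ε (upper-identity (G x) _ _ ε)) (outer-total N)
        in Bs ,
           (λ { (y ∷ ys) y∷ys∈@(0≤y ∷ _ , _) →
                cover y ys y∷ys∈ (ℚ.≤-trans (ℚ.≤-reflexive (ℚ.+-inverseʳ x)) 0≤y) }) ,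
           total≤

-- The induction is on the dimension, for all nonnegative parameters at once, since the parameters
-- `t ⊕ xs` of a slice vary with its height. In dimension 0 a single box, the empty product of
-- volume 1, is all of `Π []`.
vol-hasVolume : (x : Vec ℚ n) → VecAll.All (0ℚ ℚ.≤_) x → HasVolume (Π x) (vol x)
vol-hasVolume [] [] = record
  { inner = λ ε 0<ε → point ∷ [] , [] ∷ [] , (λ { [] _ → [] , [] }) ∷ [] ,
      ≤-by (ℚ.<⇒≤ 0<ε) (trans (solve 1 (λ e → e :- con 0ℚ := con 1ℚ :- (con 1ℚ :- e)) refl ε) (cong (λ v → 1ℚ - (v - ε)) (sym vol-[])))
  ; outer = λ ε 0<ε → point ∷ [] , (λ { [] _ → here ([] , []) }) ,
      ≤-by (ℚ.<⇒≤ 0<ε) (trans (solve 1 (λ e → e :- con 0ℚ := con 1ℚ :+ e :- con 1ℚ) refl ε) (cong (λ v → v + ε - 1ℚ) (sym vol-[])))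
  }
  where
  point : Box 0
  point = record { lower = [] ; upper = [] ; lower≤upper = [] }
vol-hasVolume (x ∷ xs) (0≤x ∷ 0≤xs) =
  Slabs.hasVolume 0≤x (λ t → vol (t ⊕ xs)) (λ t → vol (t ∷ xs)) (vol-0 xs)
    (λ 0≤s s≤t → vol-≤ 0≤s s≤t 0≤xs) (λ 0≤s s≤t → vol-≥ 0≤s s≤t 0≤xs)
    (λ t 0≤t → vol-hasVolume (t ⊕ xs) (⊕-nonNeg 0≤t 0≤xs))

theorem11 : ∀ (n : ℕ) → 1 ≤ n →
    ∃ λ (V : Polynomial n) → IsVolumePolynomial V ×
    (∀ (x : Vec ℕ n) →
    P x ≡ sum (List.map (parkingMonomial x) (park n)) ×
    fromℕ (sum (List.map (parkingMonomial x) (park n))) ≡ fromℕ (n !) * eval V (Vec.map fromℕ x))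
theorem11 n _ =
  volumePolynomial n ,
  (λ x 0≤x → subst (HasVolume (Π x)) (sym (eval-volumePolynomial x)) (vol-hasVolume x 0≤x)) ,
  -- Both sides equal `parkingSum` in ℚ; injectivity of the embedding brings the equality back to ℕ.
  (λ x → fromℕ-injective (trans (fromℕ-P x) (sym (fromℕ-sum-park x))) ,
         trans (fromℕ-sum-park x) (sym (n!V x)))
  where
  n!V : ∀ x → fromℕ (n !) * eval (volumePolynomial n) (Vec.map fromℕ x) ≡ parkingSum (Vec.map fromℕ x)
  n!V x = begin
    fromℕ (n !) * eval (volumePolynomial n) (Vec.map fromℕ x)   ≡⟨ cong (fromℕ (n !) *_) (eval-volumePolynomial (Vec.map fromℕ x)) ⟩
    fromℕ (n !) * (invFact n * S)                               ≡⟨ ℚ.*-assoc (fromℕ (n !)) (invFact n) S ⟨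
    fromℕ (n !) * invFact n * S                                 ≡⟨ cong (_* S) (fromℕ-!-invFact n) ⟩
    1ℚ * S                                                      ≡⟨ ℚ.*-identityˡ S ⟩
    S                                                           ∎
    where
    open ≡-Reasoning
    S = parkingSum (Vec.map fromℕ x)
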